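{- Let $\ell$ be an odd prime, let $m\ge 0$ be an integer, and put $k=\ell m+(\ell-3)$. Let $q=e^{2\pi i\tau}$, $\zeta=e^{2\pi i z}$, and define $$C_{k,3}(z,\tau)=\prod_{n=1}^\infty\frac{(1+q^n)(1+\zeta^{\ell-2}q^n)(1+\zeta^{ -(\ell-2)}q^n)}{\big[(1-q^n)(1-\zeta^{\ell-2}q^n)(1-\zeta^{ -(\ell-2)}q^n)\big]^m\Big[\prod_{a\in\{1,3,\dots,\ell-4\}}(1-\zeta^{a}q^n)(1-\zeta^{ -a}q^n)\Big]^{m+1}}$$ (the last product being empty when $\ell=3$). Then $C_{k,3}$ is a crank generating function for $p_{k,3}(n)$, i.e. setting $\zeta=1$ gives $\sum_{n\ge0}p_{k,3}(n)q^n$, and it explains the congruences $p_{k,3}(\ell n+\delta)\equiv0\pmod{\ell}$ for every integer $\delta$ such that $4\delta+1$ is a quadratic non-residue modulo $\ell$: for every such $\delta$ and every integer $n\ge0$, the coefficient of $q^{\ell n+\delta}$ in $C_{k,3}(z,\tau)$ (a Laurent polynomial in $\zeta$ with integer coefficients) is divisible by the $\ell$-th cyclotomic polynomial $\Phi_\ell(\zeta)$ (equivalently, vanishes at $\zeta=e^{2\pi i/\ell}$); in particular $p_{k,3}(\ell n+\delta)\equiv0\pmod{\ell}$.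
   Context: For nonnegative integers $k,j$, $p_{k,j}(n)$ denotes the number of $(k+j)$-colored partitions of $n$ in which $j$ of the colors have distinct parts, i.e. $\sum_{n\ge0}p_{k,j}(n)q^n=\prod_{n\ge1}\frac{(1+q^n)^j}{(1-q^n)^k}$. An integer $a$ is a quadratic non-residue modulo $\ell$ if $a$ is not congruent to any square $x^2$ (including $0$) modulo $\ell$. -}

module Defs where

open import Data.Nat as ℕ using (ℕ; zero; suc)
open import Data.Integer as ℤ using (ℤ; +_; -[1+_])
open import Data.Integer.Divisibility as ℤ∣ using ()
open import Data.List using (List; []; _∷_; map; foldr; upTo; replicate; _++_)
open import Data.Product using (Σ; _×_)
open import Relation.Nullary using (¬_)
open import Relation.Binary.PropositionalEquality using (_≡_)

-- Laurent polynomials in ζ with integer coefficients.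
-- A value  mkLP lo cs  denotes  Σ_i cs[i] ζ^(lo+i).

addL : List ℤ → List ℤ → List ℤ
addL []       bs       = bs
addL as       []       = as
addL (a ∷ as) (b ∷ bs) = (a ℤ.+ b) ∷ addL as bs

mulL : List ℤ → List ℤ → List ℤ
mulL []       bs = []
mulL (a ∷ as) bs = addL (map (a ℤ.*_) bs) (+ 0 ∷ mulL as bs)

nthL : List ℤ → ℕ → ℤ
nthL []       _       = + 0
nthL (a ∷ as) zero    = a
nthL (a ∷ as) (suc i) = nthL as i

record LP : Set where
  constructor mkLP
  field
    lo : ℤ
    cs : List ℤ

open LP public

coeffLP : LP → ℤ → ℤ
coeffLP (mkLP l c) j with j ℤ.- l
... | + i     = nthL c i
... | -[1+ _ ] = + 0

zeroLP : LP
zeroLP = mkLP (+ 0) []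

oneLP : LP
oneLP = mkLP (+ 0) (+ 1 ∷ [])

mono : ℤ → LP
mono a = mkLP a (+ 1 ∷ [])

addLP : LP → LP → LP
addLP (mkLP l₁ c₁) (mkLP l₂ c₂) =
  let l = l₁ ℤ.⊓ l₂ in
  mkLP l (addL (replicate ℤ.∣ l₁ ℤ.- l ∣ (+ 0) ++ c₁)
               (replicate ℤ.∣ l₂ ℤ.- l ∣ (+ 0) ++ c₂))

mulLP : LP → LP → LP
mulLP (mkLP l₁ c₁) (mkLP l₂ c₂) = mkLP (l₁ ℤ.+ l₂) (mulL c₁ c₂)

evalAt1 : LP → ℤ
evalAt1 (mkLP _ c) = foldr ℤ._+_ (+ 0) c

cyclotomicPrime : ℕ → LP
cyclotomicPrime ℓ = mkLP (+ 0) (replicate ℓ (+ 1))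

_∣LP_ : LP → LP → Set
d ∣LP f = Σ LP (λ g → (j : ℤ) → coeffLP f j ≡ coeffLP (mulLP d g) j)

module Series {A : Set} (0# 1# : A) (_⊕_ _⊗_ : A → A → A) where

  PS : Set
  PS = ℕ → A

  powA : A → ℕ → A
  powA c zero    = 1#
  powA c (suc k) = c ⊗ powA c k

  oneS : PS
  oneS zero    = 1#
  oneS (suc _) = 0#

  infixl 7 _*S_
  _*S_ : PS → PS → PS
  (f *S g) n = foldr _⊕_ 0# (map (λ i → f i ⊗ g (n ℕ.∸ i)) (upTo (suc n)))

  powS : PS → ℕ → PS
  powS f zero    = oneS
  powS f (suc k) = f *S powS f k

  prodS : List PS → PS
  prodS = foldr _*S_ oneS

  onePlus : A → ℕ → PS
  onePlus c i N with N ℕ.≟ 0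
  ... | Relation.Nullary.yes _ = 1#
  ... | Relation.Nullary.no _ with N ℕ.≟ suc i
  ...   | Relation.Nullary.yes _ = c
  ...   | Relation.Nullary.no _  = 0#

  -- the factor 1 / (1 - c q^(i+1)) = Σ_t c^t q^((i+1) t)
  geomInv : A → ℕ → PS
  geomInv c i N with N ℕ.% suc i ℕ.≟ 0
  ... | Relation.Nullary.yes _ = powA c (N ℕ./ suc i)
  ... | Relation.Nullary.no _  = 0#

  -- infinite product Π_{n ≥ 1} F (n-1), where each factor F i ≡ 1 + O(q^(i+1));
  -- the coefficient of q^N only depends on the factors with n ≤ N.
  infProd : (ℕ → PS) → PS
  infProd F N = prodS (map F (upTo N)) N

  coeffZ : PS → ℤ → A
  coeffZ f (+ n)    = f n
  coeffZ f -[1+ _ ] = 0#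

module SZ  = Series (+ 0) (+ 1) ℤ._+_ ℤ._*_
module SLP = Series zeroLP oneLP addLP mulLP

pGen : ℕ → ℕ → SZ.PS
pGen k j = SZ.infProd (λ i → SZ.powS (SZ.onePlus (+ 1) i) j SZ.*S SZ.powS (SZ.geomInv (+ 1) i) k)

p : ℕ → ℕ → ℕ → ℤ
p k j n = pGen k j n

Cgen : ℕ → ℕ → SLP.PS
Cgen ℓ m = SLP.infProd factor
  where
  e : ℤ
  e = + (ℓ ℕ.∸ 2)
  odds : List ℕ
  odds = map (λ t → 1 ℕ.+ 2 ℕ.* t) (upTo ((ℓ ℕ.∸ 3) ℕ./ 2))
  factor : ℕ → SLP.PS
  factor i =
    SLP.prodS (SLP.onePlus oneLP i ∷ SLP.onePlus (mono e) i ∷ SLP.onePlus (mono (ℤ.- e)) i ∷ [])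
    SLP.*S SLP.powS (SLP.prodS (SLP.geomInv oneLP i ∷ SLP.geomInv (mono e) i ∷ SLP.geomInv (mono (ℤ.- e)) i ∷ [])) m
    SLP.*S SLP.powS (SLP.prodS (map (λ a → SLP.geomInv (mono (+ a)) i SLP.*S SLP.geomInv (mono (ℤ.- (+ a))) i) odds)) (suc m)

-- quadratic non-residue modulo ℓ (0 counts as a square)

QNR : ℕ → ℤ → Set
QNR ℓ a = ¬ Σ ℤ (λ x → (+ ℓ) ℤ∣.∣ (a ℤ.- x ℤ.* x))

{-# OPTIONS --safe #-}

-- At a primitive ℓ-th root of unity ω the exponents 0, ±1, ±3, …, ±(ℓ-2) run over all residues
-- modulo ℓ, so the n-th factor of C equals
--   (1 - q^2n)(1 - x q^2n)(1 - x⁻¹ q^2n) · [ ∏_{ρ^ℓ = 1} (1 - ρ q^n) ]^-(m+1),   x = ω^(2(ℓ-2)).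
-- The bracket is unchanged when q is replaced by ω² q, so only powers q^(ℓ s) occur in the product of
-- the brackets. By the Jacobi triple product (divided by 1 - x⁻¹) the remaining product is
--   Σ_r (-1)^r (x^r + … + x^-r) q^(r(r+1)).
-- A nonzero coefficient of q^N thus forces N ≡ r(r+1), i.e. 4N+1 ≡ (2r+1)², modulo ℓ. The computation
-- takes place in ℤ[ζ]/(1 + ζ + … + ζ^(ℓ-1)), which has no ℓ-torsion; evaluation of Laurent polynomials
-- there vanishes only on multiples of Φ_ℓ.
module Submission where

open import Defs
open import Algebra.Bundles using (CommutativeRing)
open import Algebra.Bundles.Raw using (RawRing)
import Algebra.Construct.Pointwise
import Algebra.Morphism.RingMonomorphism as RingMonomorphism
open import Algebra.Morphism.Structures using (module RingMorphisms)
import Algebra.Properties.AbelianGroup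
import Algebra.Properties.CommutativeSemiring.Exp
import Algebra.Properties.Ring
import Algebra.Properties.Semiring.Exp
import Algebra.Properties.Semiring.Mult.TCOptimised
import Algebra.Solver.Ring
open import Algebra.Solver.Ring.AlmostCommutativeRing using (_-Raw-AlmostCommutative⟶_; fromCommutativeRing)
open import Data.Empty using (⊥-elim)
open import Data.Integer as ℤ using (ℤ; +_; -[1+_])
open import Data.Integer.Divisibility as ℤ∣ using ()
open import Data.Integer.Divisibility.Signed as Signed using ()
open import Data.Integer.Properties as ℤₚ using ()
open import Data.List using (List; []; _∷_; map; foldr; upTo; applyUpTo; replicate; _++_)
open import Data.List.Properties using (map-upTo; map-applyUpTo)
open import Data.Maybe using (Maybe; just; nothing)
open import Data.Nat as ℕ using (ℕ; zero; suc; _≤_; _<_; z≤n; s≤s)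
open import Data.Nat.Coprimality using (Coprime; coprime-Bézout)
open import Data.Nat.DivMod as DivMod using ()
open import Data.Nat.Divisibility as ℕ∣ using (_∣_; _∣?_)
open import Data.Nat.GCD using (module Bézout)
open import Data.Nat.Primality using (Prime; prime⇒irreducible; prime⇒nonTrivial; euclidsLemma)
open import Data.Nat.Properties as ℕₚ using ()
open import Data.Nat.Tactic.RingSolver using (solve-∀)
open import Data.Product using (_,_; _×_; Σ; proj₁; proj₂)
open import Data.Sum using (inj₁; inj₂)
open import Function using (_∘_; id)
open import Level using (0ℓ)
import Relation.Binary.Reasoning.Setoid
open import Relation.Binary.PropositionalEquality as ≡ using (_≡_; _≢_)
open import Relation.Nullary using (yes; no; ¬_)

-- No division by 1 - x⁻¹ takes place, since it need not be possible in the ring at hand. The sums χ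
-- r = x^r + ... + x^-r are generated from t = x + x⁻¹ by a three-term recurrence, and the triple
-- product is proved as a polynomial identity: ∏_{1 ≤ i ≤ M} (1 - t Q^i + Q^2i) = Σ_r (-1)^r
-- Q^(r(r+1)/2) [2M+1 choose M-r] χ r. Multiplication by ∏_{1 ≤ i ≤ M} (1 - Q^i) clears the Gaussian
-- binomials up to an error divisible by Q^(M+1). This replaces the limit, because the coefficient
-- of q^N in C involves only the first N factors. Invariance of a series under q ↦ ω² q says ω^(2n)
-- c = c for its n-th coefficient c. If ℓ does not divide n, Bézout gives ω c = c, so ℓ c = Σ ω^i c
-- = 0, and absence of torsion yields c = 0. There is no torsion because Φ_ℓ has constant term 1: if
-- ℓ x = Φ_ℓ g, then ℓ divides every coefficient of g. The congruence for p_{k,3} comes from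
-- evaluation at ζ = 1, where C becomes its generating function and Φ_ℓ becomes ℓ.

-- The canonical map from ℤ to a commutative ring, and a ring solver with integer coefficients.

module IntegerCoefficients {c ℓ} (R : CommutativeRing c ℓ) where

  open CommutativeRing R
  open Algebra.Properties.Ring ring
  open Algebra.Properties.AbelianGroup +-abelianGroup using (⁻¹-∙-comm)
  open Algebra.Properties.Semiring.Mult.TCOptimised semiring using (×-homo-+; ×1-homo-*; 1+×) renaming (_×_ to _×ₙ_)
  open Relation.Binary.Reasoning.Setoid setoid

  fromℤ : ℤ → Carrier
  fromℤ (+ n)    = n ×ₙ 1#
  fromℤ -[1+ n ] = - (suc n ×ₙ 1#)

  fromℤ-⊖ : ∀ m n → fromℤ (m ℤ.⊖ n) ≈ (m ×ₙ 1#) - (n ×ₙ 1#)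
  fromℤ-⊖ m zero = sym (trans (+-congˡ -0#≈0#) (+-identityʳ _))
  fromℤ-⊖ zero (suc n) = sym (+-identityˡ _)
  fromℤ-⊖ (suc m) (suc n) = begin
    fromℤ (suc m ℤ.⊖ suc n)           ≡⟨ ≡.cong fromℤ (ℤₚ.[1+m]⊖[1+n]≡m⊖n m n) ⟩
    fromℤ (m ℤ.⊖ n)                   ≈⟨ fromℤ-⊖ m n ⟩
    a - b                             ≈⟨ +-congʳ (sym (trans (+-assoc _ _ _) (trans (+-congˡ (-‿inverseʳ 1#)) (+-identityʳ _)))) ⟩
    (a + 1# - 1#) - b                 ≈⟨ +-assoc _ _ _ ⟩
    (a + 1#) + (- 1# - b)             ≈⟨ +-cong (+-comm _ _) (⁻¹-∙-comm _ _) ⟩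
    (1# + a) - (1# + b)               ≈⟨ +-cong (1+× m 1#) (-‿cong (1+× n 1#)) ⟨
    (suc m ×ₙ 1#) - (suc n ×ₙ 1#)     ∎
    where
    a = m ×ₙ 1#
    b = n ×ₙ 1#

  fromℤ-neg : ∀ i → fromℤ (ℤ.- i) ≈ - fromℤ i
  fromℤ-neg (+ zero)  = sym -0#≈0#
  fromℤ-neg (+ suc n) = refl
  fromℤ-neg -[1+ n ]  = sym (-‿involutive _)

  fromℤ-+ : ∀ i j → fromℤ (i ℤ.+ j) ≈ fromℤ i + fromℤ j
  fromℤ-+ (+ m)    (+ n)    = ×-homo-+ 1# m n
  fromℤ-+ (+ m)    -[1+ n ] = fromℤ-⊖ m (suc n)
  fromℤ-+ -[1+ m ] (+ n)    = trans (fromℤ-⊖ n (suc m)) (+-comm _ _)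
  fromℤ-+ -[1+ m ] -[1+ n ] = begin
    - (suc (suc (m ℕ.+ n)) ×ₙ 1#)       ≡⟨ ≡.cong (λ k → - (suc k ×ₙ 1#)) (≡.sym (ℕₚ.+-suc m n)) ⟩
    - ((suc m ℕ.+ suc n) ×ₙ 1#)         ≈⟨ -‿cong (×-homo-+ 1# (suc m) (suc n)) ⟩
    - (suc m ×ₙ 1# + suc n ×ₙ 1#)       ≈⟨ sym (⁻¹-∙-comm _ _) ⟩
    - (suc m ×ₙ 1#) - (suc n ×ₙ 1#)     ∎

  fromℤ-*-pos : ∀ m j → fromℤ (+ m ℤ.* j) ≈ fromℤ (+ m) * fromℤ j
  fromℤ-*-pos m (+ n) = trans (reflexive (≡.cong fromℤ (≡.sym (ℤₚ.pos-* m n)))) (×1-homo-* m n)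
  fromℤ-*-pos m -[1+ n ] = begin
    fromℤ (+ m ℤ.* (ℤ.- (+ suc n)))   ≡⟨ ≡.cong fromℤ (≡.sym (ℤₚ.neg-distribʳ-* (+ m) (+ suc n))) ⟩
    fromℤ (ℤ.- (+ m ℤ.* + suc n))     ≈⟨ fromℤ-neg (+ m ℤ.* + suc n) ⟩
    - fromℤ (+ m ℤ.* + suc n)         ≈⟨ -‿cong (fromℤ-*-pos m (+ suc n)) ⟩
    - (fromℤ (+ m) * fromℤ (+ suc n)) ≈⟨ -‿distribʳ-* _ _ ⟩
    fromℤ (+ m) * fromℤ -[1+ n ]      ∎

  fromℤ-* : ∀ i j → fromℤ (i ℤ.* j) ≈ fromℤ i * fromℤ j
  fromℤ-* (+ m) j = fromℤ-*-pos m j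
  fromℤ-* -[1+ m ] j = begin
    fromℤ (ℤ.- (+ suc m) ℤ.* j)       ≡⟨ ≡.cong fromℤ (≡.sym (ℤₚ.neg-distribˡ-* (+ suc m) j)) ⟩
    fromℤ (ℤ.- (+ suc m ℤ.* j))       ≈⟨ fromℤ-neg (+ suc m ℤ.* j) ⟩
    - fromℤ (+ suc m ℤ.* j)           ≈⟨ -‿cong (fromℤ-*-pos (suc m) j) ⟩
    - (fromℤ (+ suc m) * fromℤ j)     ≈⟨ -‿distribˡ-* _ _ ⟩
    fromℤ -[1+ m ] * fromℤ j          ∎

  private
    morphism : ℤ.+-*-rawRing -Raw-AlmostCommutative⟶ fromCommutativeRing R
    morphism = record
      { ⟦_⟧    = fromℤ
      ; +-homo = fromℤ-+
      ; *-homo = fromℤ-*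
      ; -‿homo = fromℤ-neg
      ; 0-homo = refl
      ; 1-homo = refl
      }

    weaklyDecidable : ∀ i j → Maybe (fromℤ i ≈ fromℤ j)
    weaklyDecidable i j with i ℤ.≟ j
    ... | yes ≡.refl = just refl
    ... | no _       = nothing

  open Algebra.Solver.Ring ℤ.+-*-rawRing (fromCommutativeRing R) morphism weaklyDecidable public
    using (Polynomial; solve; _:=_; con; _:+_; _:*_; :-_; _:-_)

  𝟙 : ∀ {n} → Polynomial n
  𝟙 = con (+ 1)

module FiniteProducts {c ℓ} (R : CommutativeRing c ℓ) where

  open CommutativeRing R
  open IntegerCoefficients R

  ∏ ∑ : ℕ → (ℕ → Carrier) → Carrier
  ∏ zero    f = 1#
  ∏ (suc n) f = ∏ n f * f n
  ∑ zero    f = 0#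
  ∑ (suc n) f = ∑ n f + f n

  ∏-cong : ∀ n {f g} → (∀ i → i < n → f i ≈ g i) → ∏ n f ≈ ∏ n g
  ∏-cong zero    p = refl
  ∏-cong (suc n) p = *-cong (∏-cong n (λ i i<n → p i (ℕₚ.m<n⇒m<1+n i<n))) (p n ℕₚ.≤-refl)

  ∑-cong : ∀ n {f g} → (∀ i → i < n → f i ≈ g i) → ∑ n f ≈ ∑ n g
  ∑-cong zero    p = refl
  ∑-cong (suc n) p = +-cong (∑-cong n (λ i i<n → p i (ℕₚ.m<n⇒m<1+n i<n))) (p n ℕₚ.≤-refl)

  ∏-* : ∀ n f g → ∏ n (λ i → f i * g i) ≈ ∏ n f * ∏ n g
  ∏-* zero    f g = sym (*-identityˡ 1#)
  ∏-* (suc n) f g = trans (*-congʳ (∏-* n f g))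
    (solve 4 (λ a b c d → a :* b :* (c :* d) := a :* c :* (b :* d)) refl _ _ _ _)

  *-distribˡ-∑ : ∀ n c f → c * ∑ n f ≈ ∑ n (λ i → c * f i)
  *-distribˡ-∑ zero    c f = zeroʳ c
  *-distribˡ-∑ (suc n) c f = trans (distribˡ _ _ _) (+-congʳ (*-distribˡ-∑ n c f))

  ∏-sucˡ : ∀ n f → ∏ (suc n) f ≈ f 0 * ∏ n (f ∘ suc)
  ∏-sucˡ zero    f = *-comm _ _
  ∏-sucˡ (suc n) f = trans (*-congʳ (∏-sucˡ n f)) (*-assoc _ _ _)

  ∑-sucˡ : ∀ n f → ∑ (suc n) f ≈ f 0 + ∑ n (f ∘ suc)
  ∑-sucˡ zero    f = +-comm _ _
  ∑-sucˡ (suc n) f = trans (+-congʳ (∑-sucˡ n f)) (+-assoc _ _ _)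

  ∏-+ : ∀ m n f → ∏ (m ℕ.+ n) f ≈ ∏ m f * ∏ n (λ i → f (m ℕ.+ i))
  ∏-+ m zero    f = trans (reflexive (≡.cong (λ k → ∏ k f) (ℕₚ.+-identityʳ m))) (sym (*-identityʳ _))
  ∏-+ m (suc n) f = trans (reflexive (≡.cong (λ k → ∏ k f) (ℕₚ.+-suc m n)))
    (trans (*-congʳ (∏-+ m n f)) (*-assoc _ _ _))

-- A finite form of the Jacobi triple product.

module JacobiTripleProduct {c ℓ} (R : CommutativeRing c ℓ) (t Q : CommutativeRing.Carrier R) where

  open CommutativeRing R
  open IntegerCoefficients R
  open FiniteProducts R
  open Algebra.Properties.Semiring.Exp semiring
  open Relation.Binary.Reasoning.Setoid setoid

  ^-sum : ∀ {k} m n → k ≡ m ℕ.+ n → Q ^ k ≈ Q ^ m * Q ^ n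
  ^-sum m n ≡.refl = ^-homo-* Q m n

  -- gauss a b is the Gaussian binomial coefficient [a + b choose a] in base Q.
  gauss : ℕ → ℕ → Carrier
  gauss zero    b       = 1#
  gauss (suc a) zero    = 1#
  gauss (suc a) (suc b) = gauss a (suc b) + Q ^ suc a * gauss (suc a) b

  gauss-zeroʳ : ∀ a → gauss a 0 ≡ 1#
  gauss-zeroʳ zero    = ≡.refl
  gauss-zeroʳ (suc a) = ≡.refl

  -- Ratios of neighbouring Gaussian binomials, cross-multiplied because 1 - Q^k need not be
  -- cancellable. The two statements are proved together: a Pascal step in either one is closed by
  -- the equality of `(1# - A) * Y` and `(1# - B) * X`, which both statements at smaller indices
  -- supply.
  gauss-sucˡ : ∀ a b → (1# - Q ^ suc a) * gauss (suc a) b ≈ (1# - Q ^ suc (a ℕ.+ b)) * gauss a b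
  gauss-sucʳ : ∀ a b → (1# - Q ^ suc b) * gauss a (suc b) ≈ (1# - Q ^ suc (a ℕ.+ b)) * gauss a b
  gauss-sucˡ a zero = reflexive (≡.cong₂ (λ k x → (1# - Q ^ suc k) * x) (≡.sym (ℕₚ.+-identityʳ a)) (≡.sym (gauss-zeroʳ a)))
  gauss-sucˡ a (suc b) = begin
    (1# - A) * (X + A * Y)
      ≈⟨ solve 3 (λ A X Y → (𝟙 :- A) :* (X :+ A :* Y) := (𝟙 :- A) :* X :+ A :* ((𝟙 :- A) :* Y)) refl A X Y ⟩
    (1# - A) * X + A * ((1# - A) * Y)
      ≈⟨ +-congˡ (*-congˡ (trans (gauss-sucˡ a b) (sym (gauss-sucʳ a b)))) ⟩
    (1# - A) * X + A * ((1# - B) * X)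
      ≈⟨ solve 3 (λ A B X → (𝟙 :- A) :* X :+ A :* ((𝟙 :- B) :* X) := (𝟙 :- A :* B) :* X) refl A B X ⟩
    (1# - A * B) * X
      ≈⟨ *-congʳ (+-congˡ (-‿cong (^-homo-* Q (suc a) (suc b)))) ⟨
    (1# - Q ^ suc (a ℕ.+ suc b)) * X ∎
    where
    A = Q ^ suc a
    B = Q ^ suc b
    X = gauss a (suc b)
    Y = gauss (suc a) b
  gauss-sucʳ zero b = refl
  gauss-sucʳ (suc a) b = begin
    (1# - B) * (X + A * Y)
      ≈⟨ solve 4 (λ A B X Y → (𝟙 :- B) :* (X :+ A :* Y) := (𝟙 :- B) :* X :+ (𝟙 :- B) :* (A :* Y)) refl A B X Y ⟩
    (1# - B) * X + (1# - B) * (A * Y)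
      ≈⟨ +-congʳ (trans (gauss-sucʳ a b) (sym (gauss-sucˡ a b))) ⟩
    (1# - A) * Y + (1# - B) * (A * Y)
      ≈⟨ solve 3 (λ A B Y → (𝟙 :- A) :* Y :+ (𝟙 :- B) :* (A :* Y) := (𝟙 :- A :* B) :* Y) refl A B Y ⟩
    (1# - A * B) * Y
      ≈⟨ *-congʳ (+-congˡ (-‿cong (^-sum (suc a) (suc b) (≡.cong suc (≡.sym (ℕₚ.+-suc a b)))))) ⟨
    (1# - Q ^ suc (suc a ℕ.+ b)) * Y ∎
    where
    A = Q ^ suc a
    B = Q ^ suc b
    X = gauss a (suc b)
    Y = gauss (suc a) b

  -- The second Pascal rule. The two expansions differ by (1 - B) X - (1 - A) Y, which vanishes by
  -- the ratio identities.
  gauss-pascal : ∀ a b → gauss (suc a) (suc b) ≈ gauss (suc a) b + Q ^ suc b * gauss a (suc b)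
  gauss-pascal a b = begin
    X + A * Y                       ≈⟨ solve 4 (λ A B X Y → X :+ A :* Y := (𝟙 :- B) :* X :+ (A :* Y :+ B :* X)) refl A B X Y ⟩
    (1# - B) * X + (A * Y + B * X)  ≈⟨ +-congʳ (trans (gauss-sucʳ a b) (sym (gauss-sucˡ a b))) ⟩
    (1# - A) * Y + (A * Y + B * X)  ≈⟨ solve 4 (λ A B X Y → (𝟙 :- A) :* Y :+ (A :* Y :+ B :* X) := Y :+ B :* X) refl A B X Y ⟩
    Y + B * X                       ∎
    where
    A = Q ^ suc a
    B = Q ^ suc b
    X = gauss a (suc b)
    Y = gauss (suc a) b

  gauss-sym : ∀ a b → gauss a b ≈ gauss b a
  gauss-sym zero    b       = reflexive (≡.sym (gauss-zeroʳ b))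
  gauss-sym (suc a) zero    = refl
  gauss-sym (suc a) (suc b) = trans (+-cong (gauss-sym a (suc b)) (*-congˡ (gauss-sym (suc a) b))) (sym (gauss-pascal b a))

  -- gauss⁻ a b is [a - 1 + b choose a - 1], with value 0 at a = 0.
  gauss⁻ : ℕ → ℕ → Carrier
  gauss⁻ zero    b = 0#
  gauss⁻ (suc a) b = gauss a b

  -- Combining both Pascal rules raises the upper index by two. This is the recursion of `coeff`,
  -- whose upper index 2M + 1 grows by two with each new factor.
  gauss-step₂ : ∀ a j → gauss (suc a) (2 ℕ.+ j) ≈
    (1# + Q ^ suc a * Q ^ suc j) * gauss a (suc j) + Q ^ suc a * gauss (suc a) j + Q ^ (2 ℕ.+ j) * gauss⁻ a (2 ℕ.+ j)
  gauss-step₂ a j = begin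
    gauss a (2 ℕ.+ j) + A * gauss (suc a) (suc j)
      ≈⟨ +-cong (pascal a) (*-congˡ (gauss-pascal a j)) ⟩
    (X + J * U) + A * (Y + B * X)
      ≈⟨ solve 6 (λ A B J X Y U → (X :+ J :* U) :+ A :* (Y :+ B :* X) := (𝟙 :+ A :* B) :* X :+ A :* Y :+ J :* U) refl A B J X Y U ⟩
    (1# + A * B) * X + A * Y + J * U ∎
    where
    A = Q ^ suc a
    B = Q ^ suc j
    J = Q ^ (2 ℕ.+ j)
    X = gauss a (suc j)
    Y = gauss (suc a) j
    U = gauss⁻ a (2 ℕ.+ j)
    pascal : ∀ a → gauss a (2 ℕ.+ j) ≈ gauss a (suc j) + J * gauss⁻ a (2 ℕ.+ j)
    pascal zero    = sym (trans (+-congˡ (zeroʳ _)) (+-identityʳ _))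
    pascal (suc a) = gauss-pascal a (suc j)

  -- With t = x + 1/x this is χ r = x^r + x^(r-1) + ... + x^(-r).
  χ : ℕ → Carrier
  χ zero          = 1#
  χ (suc zero)    = t + 1#
  χ (suc (suc r)) = t * χ (suc r) - χ r

  -- Multiplication by t = x + 1/x in the basis χ, using t χ r = χ (r+1) + χ (r-1) with χ (-1) = - χ 0.
  t-action : (ℕ → Carrier) → ℕ → Carrier
  t-action f zero    = f 1 - f 0
  t-action f (suc r) = f r + f (2 ℕ.+ r)

  -- Cutting the sum at M leaves two boundary terms: the top term is pushed out to `χ (suc M)`, and
  -- `t-action f M` counts a contribution of `f (suc M)` that the cut sum does not contain.
  t*∑χ : ∀ f M → t * ∑ (suc M) (λ r → f r * χ r) ≈
    ∑ (suc M) (λ r → t-action f r * χ r) + f M * χ (suc M) - f (suc M) * χ M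
  t*∑χ f zero = solve 3 (λ t a b → t :* (con (+ 0) :+ a :* 𝟙) := con (+ 0) :+ (b :- a) :* 𝟙 :+ a :* (t :+ 𝟙) :- b :* 𝟙) refl t (f 0) (f 1)
  t*∑χ f (suc M) = begin
    t * (∑ (suc M) (λ r → f r * χ r) + f (suc M) * X)
      ≈⟨ distribˡ _ _ _ ⟩
    t * ∑ (suc M) (λ r → f r * χ r) + t * (f (suc M) * X)
      ≈⟨ +-congʳ (t*∑χ f M) ⟩
    (S + f M * X - f (suc M) * χ M) + t * (f (suc M) * X)
      ≈⟨ solve 7 (λ S a b c X Y t → (S :+ a :* X :- b :* Y) :+ t :* (b :* X) := (S :+ (a :+ c) :* X) :+ b :* (t :* X :- Y) :- c :* X) refl S (f M) (f (suc M)) (f (2 ℕ.+ M)) X (χ M) t ⟩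
    (S + (f M + f (2 ℕ.+ M)) * X) + f (suc M) * (t * X - χ M) - f (2 ℕ.+ M) * X ∎
    where
    X = χ (suc M)
    S = ∑ (suc M) (λ r → t-action f r * χ r)

  -- Formal coordinates of `∏ M quadratic` along χ. The recursion is multiplication by 1 - t u + u²
  -- with u = Q^(M+1).
  coeff : ℕ → ℕ → Carrier
  coeff zero    zero    = 1#
  coeff zero    (suc r) = 0#
  coeff (suc M) r       = (1# + Q ^ suc M * Q ^ suc M) * coeff M r - Q ^ suc M * t-action (coeff M) r

  coeff-vanish : ∀ M r → M < r → coeff M r ≈ 0#
  coeff-vanish zero    (suc r) _ = refl
  coeff-vanish (suc M) (suc r) (s≤s M<r) = trans
    (+-cong (*-congˡ (coeff-vanish M (suc r) (ℕₚ.m<n⇒m<1+n M<r)))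
      (-‿cong (*-congˡ (+-cong (coeff-vanish M r M<r) (coeff-vanish M (2 ℕ.+ r) (ℕₚ.m<n⇒m<1+n (ℕₚ.m<n⇒m<1+n M<r)))))))
    (solve 1 (λ u → (𝟙 :+ u :* u) :* con (+ 0) :- u :* (con (+ 0) :+ con (+ 0)) := con (+ 0)) refl (Q ^ suc M))

  quadratic : ℕ → Carrier
  quadratic i = 1# - t * Q ^ suc i + Q ^ suc i * Q ^ suc i

  ∏-quadratic : ∀ M → ∏ M quadratic ≈ ∑ (suc M) (λ r → coeff M r * χ r)
  ∏-quadratic zero    = sym (trans (+-identityˡ _) (*-identityʳ _))
  ∏-quadratic (suc M) = begin
    ∏ M quadratic * (1# - t * u + u * u)
      ≈⟨ *-congʳ (∏-quadratic M) ⟩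
    S * (1# - t * u + u * u)
      ≈⟨ solve 3 (λ S t u → S :* (𝟙 :- t :* u :+ u :* u) := (𝟙 :+ u :* u) :* S :- u :* (t :* S)) refl S t u ⟩
    (1# + u * u) * S - u * (t * S)
      ≈⟨ +-congˡ (-‿cong (*-congˡ (t*∑χ d M))) ⟩
    (1# + u * u) * S - u * (S′ + d M * X - d (suc M) * χ M)
      ≈⟨ solve 7 (λ v u S S′ a e Y → v :* S :- u :* (S′ :+ a :- e :* Y) := (v :* S :- u :* S′) :+ (u :* e :* Y :- u :* a)) refl (1# + u * u) u S S′ (d M * X) (d (suc M)) (χ M) ⟩
    ((1# + u * u) * S - u * S′) + (u * d (suc M) * χ M - u * (d M * X))
      ≈⟨ +-cong (∑-step (suc M)) last ⟩
    ∑ (suc M) (λ r → coeff (suc M) r * χ r) + coeff (suc M) (suc M) * X ∎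
    where
    u = Q ^ suc M
    d = coeff M
    X = χ (suc M)
    S = ∑ (suc M) (λ r → d r * χ r)
    S′ = ∑ (suc M) (λ r → t-action d r * χ r)
    ∑-step : ∀ n → (1# + u * u) * ∑ n (λ r → d r * χ r) - u * ∑ n (λ r → t-action d r * χ r) ≈ ∑ n (λ r → coeff (suc M) r * χ r)
    ∑-step zero    = solve 1 (λ u → (𝟙 :+ u :* u) :* con (+ 0) :- u :* con (+ 0) := con (+ 0)) refl u
    ∑-step (suc n) = trans
      (solve 7 (λ v u a b S S′ x → v :* (S :+ a :* x) :- u :* (S′ :+ b :* x) := (v :* S :- u :* S′) :+ (v :* a :- u :* b) :* x) refl (1# + u * u) u (d n) (t-action d n) _ _ (χ n))
      (+-congʳ (∑-step n))
    d₁≈0 = coeff-vanish M (suc M) ℕₚ.≤-refl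
    d₂≈0 = coeff-vanish M (2 ℕ.+ M) (ℕₚ.m<n⇒m<1+n ℕₚ.≤-refl)
    last : u * d (suc M) * χ M - u * (d M * X) ≈ ((1# + u * u) * d (suc M) - u * (d M + d (2 ℕ.+ M))) * X
    last = trans (+-congʳ (*-congʳ (*-congˡ d₁≈0))) (trans
      (solve 4 (λ u Y a X → u :* con (+ 0) :* Y :- u :* (a :* X) := ((𝟙 :+ u :* u) :* con (+ 0) :- u :* (a :+ con (+ 0))) :* X) refl u (χ M) (d M) X)
      (*-congʳ (sym (+-cong (*-congˡ d₁≈0) (-‿cong (*-congˡ (+-congˡ d₂≈0)))))))

  -- sign r = (-1)^r Q^(r(r+1)/2)
  sign : ℕ → Carrier
  sign zero    = 1#
  sign (suc r) = - (Q ^ suc r * sign r)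

  -- For a = M - r and b = M + r + 1 the value `gauss a b` is [2M+1 choose M-r]. Stating M and b
  -- through equations lets the induction on M reach r - 1, r and r + 1 with their indices written
  -- differently. The companion covers r = M + 1 as well, where both sides are 0.
  coeff-gauss : ∀ M a r b → M ≡ a ℕ.+ r → b ≡ suc (a ℕ.+ (r ℕ.+ r)) → coeff M r ≈ sign r * gauss a b
  coeff-gauss⁻ : ∀ M a r b → suc M ≡ a ℕ.+ r → b ≡ a ℕ.+ (r ℕ.+ r) → coeff M r ≈ sign r * gauss⁻ a b
  coeff-gauss⁻ M zero    r b p q = trans (coeff-vanish M r (ℕₚ.≤-reflexive p)) (sym (zeroʳ _))
  coeff-gauss⁻ M (suc a) r b p q = coeff-gauss M a r b (ℕₚ.suc-injective p) q
  coeff-gauss zero zero zero b p q = sym (*-identityʳ _)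
  coeff-gauss (suc M) zero (suc .M) b ≡.refl q = begin
    (1# + u * u) * coeff M (suc M) - u * (coeff M M + coeff M (2 ℕ.+ M))
      ≈⟨ +-cong (*-congˡ (coeff-vanish M (suc M) ℕₚ.≤-refl)) (-‿cong (*-congˡ (+-cong (coeff-gauss M 0 M _ ≡.refl ≡.refl) (coeff-vanish M (2 ℕ.+ M) (ℕₚ.m<n⇒m<1+n ℕₚ.≤-refl))))) ⟩
    (1# + u * u) * 0# - u * (sign M * 1# + 0#)
      ≈⟨ solve 2 (λ u s → (𝟙 :+ u :* u) :* con (+ 0) :- u :* (s :* 𝟙 :+ con (+ 0)) := :- (u :* s) :* 𝟙) refl u (sign M) ⟩
    - (u * sign M) * 1# ∎
    where u = Q ^ suc M
  coeff-gauss (suc M) (suc a) zero b p ≡.refl with ≡.trans (ℕₚ.suc-injective p) (ℕₚ.+-identityʳ a)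
  ... | ≡.refl = begin
    (1# + u * u) * coeff M 0 - u * (coeff M 1 - coeff M 0)
      ≈⟨ +-cong (*-congˡ d₀) (-‿cong (*-congˡ (+-cong (coeff-gauss⁻ M M 1 (2 ℕ.+ M) (≡.sym (ℕₚ.+-comm M 1)) (ℕₚ.+-comm 2 M)) (-‿cong d₀)))) ⟩
    (1# + u * u) * (1# * X) - u * (- (Q ^ 1 * 1#) * U - 1# * X)
      ≈⟨ solve 4 (λ u X U Q → (𝟙 :+ u :* u) :* (𝟙 :* X) :- u :* (:- (Q :* 𝟙 :* 𝟙) :* U :- 𝟙 :* X) := (𝟙 :+ u :* u) :* X :+ u :* X :+ Q :* u :* U) refl u X U Q ⟩
    (1# + u * u) * X + u * X + Q * u * U
      -- The reflection χ (-1) = - χ 0 has produced u X. The symmetry of the central coefficients,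
      -- [2M+1 choose M] = [2M+1 choose M+1], turns it into the middle term of `gauss-step₂`.
      ≈⟨ +-congʳ (+-congˡ (*-congˡ (gauss-sym M (suc M)))) ⟩
    (1# + u * u) * X + u * gauss (suc M) M + Q * u * U
      ≈⟨ gauss-step₂ M M ⟨
    gauss (suc M) (2 ℕ.+ M)
      ≈⟨ *-identityˡ _ ⟨
    1# * gauss (suc M) (2 ℕ.+ M)
      ≡⟨ ≡.cong (λ k → 1# * gauss (suc M) (2 ℕ.+ k)) (≡.sym (ℕₚ.+-identityʳ M)) ⟩
    1# * gauss (suc M) (suc (suc M ℕ.+ 0)) ∎
    where
    u = Q ^ suc M
    X = gauss M (suc M)
    U = gauss⁻ M (2 ℕ.+ M)
    d₀ : coeff M 0 ≈ 1# * X
    d₀ = coeff-gauss M M 0 (suc M) (≡.sym (ℕₚ.+-identityʳ M)) (≡.cong suc (≡.sym (ℕₚ.+-identityʳ M)))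
  coeff-gauss (suc M) (suc a) (suc r) b p q with ℕₚ.suc-injective p
  ... | ≡.refl = begin
    (1# + u * u) * coeff M (suc r) - u * (coeff M r + coeff M (2 ℕ.+ r))
      ≈⟨ +-cong (*-congˡ (coeff-gauss M a (suc r) (suc j) ≡.refl (e₁ a r)))
                (-‿cong (*-congˡ (+-cong (coeff-gauss M (suc a) r j (ℕₚ.+-suc a r) (e₂ a r))
                                         (coeff-gauss⁻ M a (2 ℕ.+ r) (2 ℕ.+ j) (e₃ a r) (e₄ a r))))) ⟩
    (1# + u * u) * (s * X) - u * (sign r * Y + - (V * s) * U)
      ≈⟨ +-cong (*-congʳ (+-congˡ u²)) (-‿cong (+-congʳ′ (*-congʳ u₁))) ⟩
    (1# + A * B) * (s * X) - (A * W * (sign r * Y) + u * (- (V * s) * U))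
      ≈⟨ solve 10 (λ A B W σ X Y U u V s →
            (𝟙 :+ A :* B) :* (s :* X) :- (A :* W :* (σ :* Y) :+ u :* (:- (V :* s) :* U)) :=
            (𝟙 :+ A :* B) :* (s :* X) :+ A :* ((:- (W :* σ)) :* Y) :+ (u :* V) :* (s :* U)) refl A B W (sign r) X Y U u V s ⟩
    (1# + A * B) * (s * X) + A * (s * Y) + u * V * (s * U)
      ≈⟨ +-congˡ (*-congʳ (sym (^-sum (suc M) (2 ℕ.+ r) (e₅ a r)))) ⟩
    (1# + A * B) * (s * X) + A * (s * Y) + Q ^ (2 ℕ.+ j) * (s * U)
      ≈⟨ solve 7 (λ A B s X Y J U → (𝟙 :+ A :* B) :* (s :* X) :+ A :* (s :* Y) :+ J :* (s :* U) := s :* ((𝟙 :+ A :* B) :* X :+ A :* Y :+ J :* U)) refl A B s X Y (Q ^ (2 ℕ.+ j)) U ⟩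
    s * ((1# + A * B) * X + A * Y + Q ^ (2 ℕ.+ j) * U)
      ≈⟨ *-congˡ (gauss-step₂ a j) ⟨
    s * gauss (suc a) (2 ℕ.+ j)
      ≡⟨ ≡.cong (λ k → s * gauss (suc a) k) (≡.trans (e₆ a r) (≡.sym q)) ⟩
    s * gauss (suc a) b ∎
    where
    j = 2 ℕ.+ (a ℕ.+ (r ℕ.+ r))
    u = Q ^ suc M
    s = sign (suc r)
    A = Q ^ suc a
    B = Q ^ suc j
    V = Q ^ (2 ℕ.+ r)
    W = Q ^ suc r
    X = gauss a (suc j)
    Y = gauss (suc a) j
    U = gauss⁻ a (2 ℕ.+ j)
    e₁ : ∀ a r → 3 ℕ.+ (a ℕ.+ (r ℕ.+ r)) ≡ suc (a ℕ.+ (suc r ℕ.+ suc r))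
    e₁ = solve-∀
    e₂ : ∀ a r → 2 ℕ.+ (a ℕ.+ (r ℕ.+ r)) ≡ suc (suc a ℕ.+ (r ℕ.+ r))
    e₂ = solve-∀
    e₃ : ∀ a r → suc (a ℕ.+ suc r) ≡ a ℕ.+ (2 ℕ.+ r)
    e₃ = solve-∀
    e₄ : ∀ a r → 4 ℕ.+ (a ℕ.+ (r ℕ.+ r)) ≡ a ℕ.+ ((2 ℕ.+ r) ℕ.+ (2 ℕ.+ r))
    e₄ = solve-∀
    e₅ : ∀ a r → 4 ℕ.+ (a ℕ.+ (r ℕ.+ r)) ≡ suc (a ℕ.+ suc r) ℕ.+ (2 ℕ.+ r)
    e₅ = solve-∀
    e₆ : ∀ a r → 4 ℕ.+ (a ℕ.+ (r ℕ.+ r)) ≡ suc (suc a ℕ.+ (suc r ℕ.+ suc r))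
    e₆ = solve-∀
    e₇ : ∀ a r → suc (a ℕ.+ suc r) ℕ.+ suc (a ℕ.+ suc r) ≡ suc a ℕ.+ (3 ℕ.+ (a ℕ.+ (r ℕ.+ r)))
    e₇ = solve-∀
    u² : u * u ≈ A * B
    u² = trans (sym (^-homo-* Q (suc M) (suc M))) (^-sum (suc a) (suc j) (e₇ a r))
    u₁ : u ≈ A * W
    u₁ = ^-sum (suc a) (suc r) ≡.refl
    +-congʳ′ : u * (sign r * Y) ≈ A * W * (sign r * Y) → u * (sign r * Y + - (V * s) * U) ≈ A * W * (sign r * Y) + u * (- (V * s) * U)
    +-congʳ′ e = trans (distribˡ _ _ _) (+-congʳ e)

  shiftedFactorial : ℕ → ℕ → Carrier
  shiftedFactorial b n = ∏ n (λ i → 1# - Q ^ suc (b ℕ.+ i))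

  factorial*gauss : ∀ a b → shiftedFactorial 0 a * gauss a b ≈ shiftedFactorial b a
  factorial*gauss zero    b = *-identityˡ _
  factorial*gauss (suc a) b = begin
    F * (1# - Q ^ suc a) * gauss (suc a) b     ≈⟨ *-assoc _ _ _ ⟩
    F * ((1# - Q ^ suc a) * gauss (suc a) b)   ≈⟨ *-congˡ (gauss-sucˡ a b) ⟩
    F * ((1# - Q ^ suc (a ℕ.+ b)) * gauss a b) ≈⟨ solve 3 (λ F x g → F :* (x :* g) := F :* g :* x) refl _ _ _ ⟩
    F * gauss a b * (1# - Q ^ suc (a ℕ.+ b))   ≈⟨ *-cong (factorial*gauss a b) (reflexive (≡.cong (λ k → 1# - Q ^ suc k) (ℕₚ.+-comm a b))) ⟩
    shiftedFactorial b a * (1# - Q ^ suc (b ℕ.+ a)) ∎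
    where F = shiftedFactorial 0 a

  shiftedFactorial≈1 : ∀ a c n → Σ Carrier λ z → shiftedFactorial (a ℕ.+ c) n ≈ 1# + Q ^ suc a * z
  shiftedFactorial≈1 a c zero    = 0# , sym (trans (+-congˡ (zeroʳ _)) (+-identityʳ _))
  shiftedFactorial≈1 a c (suc n) with shiftedFactorial≈1 a c n
  ... | z , e = z - w - Q ^ suc a * z * w , trans
    (*-cong e (+-congˡ (-‿cong (^-sum (suc a) (c ℕ.+ n) (≡.cong suc (ℕₚ.+-assoc a c n))))))
    (solve 3 (λ A z w → (𝟙 :+ A :* z) :* (𝟙 :- A :* w) := 𝟙 :+ A :* (z :- w :- A :* z :* w)) refl (Q ^ suc a) z w)
    where w = Q ^ (c ℕ.+ n)

  sign-divisible : ∀ r → Σ Carrier λ e → sign r ≈ Q ^ r * e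
  sign-divisible zero    = 1# , sym (*-identityʳ _)
  sign-divisible (suc r) = - sign r , solve 2 (λ a b → :- (a :* b) := a :* (:- b)) refl _ _

  -- The first a factors of the factorial cancel the denominator of the Gaussian binomial, leaving
  -- its numerator. That numerator and the other r factors are 1 modulo Q^(a+1). Since `sign r` is
  -- divisible by Q^r, the error improves to Q^(a+r+1).
  factorial*coeff : ∀ a r → Σ Carrier λ z → shiftedFactorial 0 (a ℕ.+ r) * coeff (a ℕ.+ r) r ≈ sign r + Q ^ suc (a ℕ.+ r) * z
  factorial*coeff a r with shiftedFactorial≈1 a 0 r | shiftedFactorial≈1 a (suc (r ℕ.+ r)) a | sign-divisible r
  ... | z₁ , p₁ | z₂ , p₂ | e , p₃ = e * z , (begin
    shiftedFactorial 0 (a ℕ.+ r) * coeff (a ℕ.+ r) r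
      ≈⟨ *-cong (∏-+ a r _) (coeff-gauss (a ℕ.+ r) a r b ≡.refl (ℕₚ.+-suc a (r ℕ.+ r))) ⟩
    F * shiftedFactorial a r * (s * gauss a b)
      ≈⟨ solve 4 (λ F x s g → F :* x :* (s :* g) := s :* (x :* (F :* g))) refl F _ s _ ⟩
    s * (shiftedFactorial a r * (F * gauss a b))
      ≈⟨ *-congˡ (*-cong (trans (reflexive (≡.cong (λ k → shiftedFactorial k r) (≡.sym (ℕₚ.+-identityʳ a)))) p₁) (trans (factorial*gauss a b) p₂)) ⟩
    s * ((1# + A * z₁) * (1# + A * z₂))
      ≈⟨ solve 4 (λ s A z₁ z₂ → s :* ((𝟙 :+ A :* z₁) :* (𝟙 :+ A :* z₂)) := s :+ s :* (A :* (z₁ :+ z₂ :+ A :* z₁ :* z₂))) refl s A z₁ z₂ ⟩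
    s + s * (A * z)
      ≈⟨ +-congˡ (*-congʳ p₃) ⟩
    s + Q ^ r * e * (A * z)
      ≈⟨ +-congˡ (solve 4 (λ q e A z → q :* e :* (A :* z) := A :* q :* (e :* z)) refl (Q ^ r) e A z) ⟩
    s + A * Q ^ r * (e * z)
      ≈⟨ +-congˡ (*-congʳ (sym (^-homo-* Q (suc a) r))) ⟩
    s + Q ^ suc (a ℕ.+ r) * (e * z) ∎)
    where
    A = Q ^ suc a
    z = z₁ + z₂ + A * z₁ * z₂
    b = a ℕ.+ suc (r ℕ.+ r)
    F = shiftedFactorial 0 a
    s = sign r

  -- The multiple of Q^(M+1) stands in for the limit M → ∞: coefficients of lower degree see only
  -- the theta sum.
  jacobi : ∀ M → Σ Carrier λ z →
    ∏ M (λ i → (1# - Q ^ suc i) * quadratic i) ≈ ∑ (suc M) (λ r → sign r * χ r) + Q ^ suc M * z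
  jacobi M = proj₁ (collect (suc M) ℕₚ.≤-refl) , (begin
    ∏ M (λ i → (1# - Q ^ suc i) * quadratic i)          ≈⟨ ∏-* M _ _ ⟩
    F * ∏ M quadratic                                   ≈⟨ *-congˡ (∏-quadratic M) ⟩
    F * ∑ (suc M) (λ r → coeff M r * χ r)               ≈⟨ proj₂ (collect (suc M) ℕₚ.≤-refl) ⟩
    ∑ (suc M) (λ r → sign r * χ r) + Q ^ suc M * _      ∎)
    where
    F = shiftedFactorial 0 M
    term : ∀ r → r ≤ M → Σ Carrier λ z → F * coeff M r ≈ sign r + Q ^ suc M * z
    term r r≤M = ≡.subst (λ k → Σ Carrier λ z → shiftedFactorial 0 k * coeff k r ≈ sign r + Q ^ suc k * z) (ℕₚ.m∸n+n≡m r≤M) (factorial*coeff (M ℕ.∸ r) r)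
    collect : ∀ n → n ≤ suc M → Σ Carrier λ z → F * ∑ n (λ r → coeff M r * χ r) ≈ ∑ n (λ r → sign r * χ r) + Q ^ suc M * z
    collect zero    _ = 0# , solve 2 (λ F u → F :* con (+ 0) := con (+ 0) :+ u :* con (+ 0)) refl F (Q ^ suc M)
    collect (suc n) (s≤s n≤M) = proj₁ earlier + proj₁ last * χ n , (begin
      F * (∑ n (λ r → coeff M r * χ r) + coeff M n * χ n)
        ≈⟨ solve 4 (λ F S d x → F :* (S :+ d :* x) := F :* S :+ F :* d :* x) refl F _ (coeff M n) (χ n) ⟩
      F * ∑ n (λ r → coeff M r * χ r) + F * coeff M n * χ n
        ≈⟨ +-cong (proj₂ earlier) (*-congʳ (proj₂ last)) ⟩
      (S + u * proj₁ earlier) + (sign n + u * proj₁ last) * χ n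
        ≈⟨ solve 6 (λ S u z₁ s z₂ x → (S :+ u :* z₁) :+ (s :+ u :* z₂) :* x := (S :+ s :* x) :+ u :* (z₁ :+ z₂ :* x)) refl S u (proj₁ earlier) (sign n) (proj₁ last) (χ n) ⟩
      (S + sign n * χ n) + u * (proj₁ earlier + proj₁ last * χ n) ∎)
      where
      earlier = collect n (ℕₚ.m≤n⇒m≤1+n n≤M)
      last = term n n≤M
      S = ∑ n (λ r → sign r * χ r)
      u = Q ^ suc M

-- The ring of formal power series.

module PowerSeries (K : CommutativeRing 0ℓ 0ℓ) where

  open CommutativeRing K
  open IntegerCoefficients K
  open Relation.Binary.Reasoning.Setoid setoid
  open Series 0# 1# _+_ _*_ public

  -- The Cauchy product in a form that recurses on the degree, so that the ring laws follow by
  -- induction. `*S≈conv` identifies it with the fold over an index list.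
  conv : PS → PS → PS
  conv f g zero    = f 0 * g 0
  conv f g (suc n) = f 0 * g (suc n) + conv (f ∘ suc) g n

  infix 4 _≈ₛ_
  _≈ₛ_ : PS → PS → Set
  f ≈ₛ g = ∀ n → f n ≈ g n

  conv-cong : ∀ {f f′ g g′} → f ≈ₛ f′ → g ≈ₛ g′ → conv f g ≈ₛ conv f′ g′
  conv-cong p q zero    = *-cong (p 0) (q 0)
  conv-cong p q (suc n) = +-cong (*-cong (p 0) (q (suc n))) (conv-cong (p ∘ suc) q n)

  conv-sucʳ : ∀ f g n → conv f g (suc n) ≈ conv f (g ∘ suc) n + f (suc n) * g 0
  conv-sucʳ f g zero    = refl
  conv-sucʳ f g (suc n) = trans (+-congˡ (conv-sucʳ (f ∘ suc) g n)) (sym (+-assoc _ _ _))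

  conv-comm : ∀ f g → conv f g ≈ₛ conv g f
  conv-comm f g zero    = *-comm _ _
  conv-comm f g (suc n) = begin
    f 0 * g (suc n) + conv (f ∘ suc) g n ≈⟨ +-cong (*-comm _ _) (conv-comm (f ∘ suc) g n) ⟩
    g (suc n) * f 0 + conv g (f ∘ suc) n ≈⟨ +-comm _ _ ⟩
    conv g (f ∘ suc) n + g (suc n) * f 0 ≈⟨ conv-sucʳ g f n ⟨
    conv g f (suc n)                     ∎

  conv-distribʳ : ∀ h f g n → conv (λ i → f i + g i) h n ≈ conv f h n + conv g h n
  conv-distribʳ h f g zero    = distribʳ _ _ _
  conv-distribʳ h f g (suc n) = trans (+-congˡ (conv-distribʳ h (f ∘ suc) (g ∘ suc) n))
    (solve 5 (λ a b x u v → (a :+ b) :* x :+ (u :+ v) := (a :* x :+ u) :+ (b :* x :+ v)) refl _ _ _ _ _)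

  conv-*ˡ : ∀ c f g n → conv (λ i → c * f i) g n ≈ c * conv f g n
  conv-*ˡ c f g zero    = *-assoc _ _ _
  conv-*ˡ c f g (suc n) = trans (+-congˡ (conv-*ˡ c (f ∘ suc) g n))
    (solve 4 (λ c x y z → c :* x :* y :+ c :* z := c :* (x :* y :+ z)) refl _ _ _ _)

  conv-zeroˡ : ∀ f g → (∀ n → f n ≈ 0#) → ∀ n → conv f g n ≈ 0#
  conv-zeroˡ f g z zero    = trans (*-congʳ (z 0)) (zeroˡ _)
  conv-zeroˡ f g z (suc n) = trans (+-cong (trans (*-congʳ (z 0)) (zeroˡ _)) (conv-zeroˡ (f ∘ suc) g (z ∘ suc) n)) (+-identityˡ _)

  conv-assoc : ∀ f g h → conv (conv f g) h ≈ₛ conv f (conv g h)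
  conv-assoc f g h zero    = *-assoc _ _ _
  conv-assoc f g h (suc n) = begin
    f 0 * g 0 * h (suc n) + conv (λ i → f 0 * g (suc i) + conv (f ∘ suc) g i) h n
      ≈⟨ +-congˡ (trans (conv-distribʳ h _ _ n) (+-cong (conv-*ˡ (f 0) (g ∘ suc) h n) (conv-assoc (f ∘ suc) g h n))) ⟩
    f 0 * g 0 * h (suc n) + (f 0 * conv (g ∘ suc) h n + conv (f ∘ suc) (conv g h) n)
      ≈⟨ solve 5 (λ a b c d e → a :* b :* c :+ (a :* d :+ e) := a :* (b :* c :+ d) :+ e) refl _ _ _ _ _ ⟩
    f 0 * (g 0 * h (suc n) + conv (g ∘ suc) h n) + conv (f ∘ suc) (conv g h) n ∎

  conv-identityˡ : ∀ f → conv oneS f ≈ₛ f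
  conv-identityˡ f zero    = *-identityˡ _
  conv-identityˡ f (suc n) = trans (+-cong (*-identityˡ _) (conv-zeroˡ (oneS ∘ suc) f (λ _ → refl) n)) (+-identityʳ _)

  powerSeries : CommutativeRing 0ℓ 0ℓ
  powerSeries = record
    { Carrier = PS
    ; _≈_ = _≈ₛ_
    ; _+_ = λ f g n → f n + g n
    ; _*_ = conv
    ; -_ = λ f n → - f n
    ; 0# = λ _ → 0#
    ; 1# = oneS
    ; isCommutativeRing = record
      { isRing = record
        { +-isAbelianGroup = Algebra.Construct.Pointwise.isAbelianGroup ℕ +-isAbelianGroup
        ; *-cong = conv-cong
        ; *-assoc = conv-assoc
        ; *-identity = conv-identityˡ , λ f n → trans (conv-comm f oneS n) (conv-identityˡ f n)
        ; distrib = (λ f g h n → trans (conv-comm f _ n) (trans (conv-distribʳ f g h n) (+-cong (conv-comm g f n) (conv-comm h f n)))) , conv-distribʳ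
        }
      ; *-comm = conv-comm
      }
    }

  *S≈conv : ∀ f g → f *S g ≈ₛ conv f g
  *S≈conv f g n = trans (reflexive (≡.cong (foldr _+_ 0#) (map-upTo _ (suc n)))) (go f n)
    where
    go : ∀ f n → foldr _+_ 0# (applyUpTo (λ i → f i * g (n ℕ.∸ i)) (suc n)) ≈ conv f g n
    go f zero    = +-identityʳ _
    go f (suc n) = +-congˡ (go (f ∘ suc) n)

-- Monomials, geometric series and the substitution q ↦ y q.

module PowerSeriesProperties (K : CommutativeRing 0ℓ 0ℓ) where

  open CommutativeRing K
  open IntegerCoefficients K
  open PowerSeries K
  open Algebra.Properties.CommutativeSemiring.Exp commutativeSemiring
  module S where
    open CommutativeRing powerSeries public
    open IntegerCoefficients powerSeries public
    open FiniteProducts powerSeries public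
    open Algebra.Properties.CommutativeSemiring.Exp (CommutativeRing.commutativeSemiring powerSeries) public
  open S using () renaming (_*_ to _*ₛ_; _^_ to _^ₛ_; _+_ to _+ₛ_; _-_ to _-ₛ_)

  conv-vanish : ∀ f g n → (∀ i j → i ℕ.+ j ≡ n → f i * g j ≈ 0#) → conv f g n ≈ 0#
  conv-vanish f g zero    p = p 0 0 ≡.refl
  conv-vanish f g (suc n) p = trans
    (+-cong (p 0 (suc n) ≡.refl) (conv-vanish (f ∘ suc) g n (λ i j e → p (suc i) j (≡.cong suc e))))
    (+-identityˡ _)

  _SupportedAt_ : PS → ℕ → Set
  f SupportedAt k = ∀ n → n ≢ k → f n ≈ 0#

  supportedAt-* : ∀ {f g k l} → f SupportedAt k → g SupportedAt l → (f *ₛ g) SupportedAt (k ℕ.+ l)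
  supportedAt-* {f} {g} {k} {l} sf sg n n≢ = conv-vanish f g n term
    where
    term : ∀ i j → i ℕ.+ j ≡ n → f i * g j ≈ 0#
    term i j e with i ℕ.≟ k
    ... | no i≢k = trans (*-congʳ (sf i i≢k)) (zeroˡ _)
    ... | yes ≡.refl = trans (*-congˡ (sg j (λ { ≡.refl → n≢ (≡.sym e) }))) (zeroʳ _)

  supportedAt-+ : ∀ {f g k} → f SupportedAt k → g SupportedAt k → (f +ₛ g) SupportedAt k
  supportedAt-+ sf sg n n≢ = trans (+-cong (sf n n≢) (sg n n≢)) (+-identityˡ _)

  supportedAt-neg : ∀ {f k} → f SupportedAt k → (S.- f) SupportedAt k
  supportedAt-neg sf n n≢ = trans (-‿cong (sf n n≢)) (solve 0 (:- con (+ 0) := con (+ 0)) refl)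

  supportedAt-1 : oneS SupportedAt 0
  supportedAt-1 zero    n≢ = ⊥-elim (n≢ ≡.refl)
  supportedAt-1 (suc n) n≢ = refl

  const : Carrier → PS
  const c zero    = c
  const c (suc _) = 0#

  supportedAt-const : ∀ c → const c SupportedAt 0
  supportedAt-const c zero    n≢ = ⊥-elim (n≢ ≡.refl)
  supportedAt-const c (suc n) n≢ = refl

  const-*ˡ : ∀ c f n → (const c *ₛ f) n ≈ c * f n
  const-*ˡ c f zero    = refl
  const-*ˡ c f (suc n) = trans (+-congˡ (conv-zeroˡ (const c ∘ suc) f (λ _ → refl) n)) (+-identityʳ _)

  const-* : ∀ c d → const c *ₛ const d S.≈ const (c * d)
  const-* c d zero    = refl
  const-* c d (suc n) = trans (const-*ˡ c (const d) (suc n)) (zeroʳ c)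

  q : PS
  q zero    = 0#
  q (suc n) = oneS n

  supportedAt-q : q SupportedAt 1
  supportedAt-q zero    n≢ = refl
  supportedAt-q (suc n) n≢ = supportedAt-1 n (n≢ ∘ ≡.cong suc)

  supportedAt-^ : ∀ {f k} → f SupportedAt k → ∀ n → (f ^ₛ n) SupportedAt (n ℕ.* k)
  supportedAt-^ sf zero    = supportedAt-1
  supportedAt-^ sf (suc n) = supportedAt-* sf (supportedAt-^ sf n)

  q^*-vanish : ∀ k f n → n < k → (q ^ₛ k *ₛ f) n ≈ 0#
  q^*-vanish k f n n<k = conv-vanish (q ^ₛ k) f n λ i j e →
    trans (*-congʳ (supportedAt-^ supportedAt-q k i (λ i≡k → ℕₚ.<⇒≢
      (ℕₚ.≤-<-trans (≡.subst (i ≤_) e (ℕₚ.m≤m+n i j)) n<k) (≡.trans i≡k (ℕₚ.*-identityʳ k))))) (zeroˡ _)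

  q^*-shift : ∀ k f n → (q ^ₛ k *ₛ f) (k ℕ.+ n) ≈ f n
  q^*-shift zero    f n = conv-identityˡ f n
  q^*-shift (suc k) f n = trans (conv-assoc q (q ^ₛ k) f (suc (k ℕ.+ n)))
    (trans (+-cong (zeroˡ _) (conv-identityˡ _ (k ℕ.+ n))) (trans (+-identityˡ _) (q^*-shift k f n)))

  powA≈^ : ∀ c n → powA c n ≡ c ^ n
  powA≈^ c zero    = ≡.refl
  powA≈^ c (suc n) = ≡.cong (c *_) (powA≈^ c n)

  +-cong-zeroʳ : ∀ {x y z} → x ≈ z → y ≈ 0# → x + y ≈ z
  +-cong-zeroʳ p e = trans (+-cong p e) (+-identityʳ _)

  onePlus-expansion : ∀ c i → onePlus c i S.≈ S.1# +ₛ const c *ₛ q ^ₛ suc i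
  onePlus-expansion c i N with N ℕ.≟ 0
  ... | yes ≡.refl = sym (+-cong-zeroʳ refl (trans (const-*ˡ c (q ^ₛ suc i) 0) (trans (*-congˡ (zeroˡ _)) (zeroʳ c))))
  ... | no N≢0 with N ℕ.≟ suc i
  ...   | yes ≡.refl = sym (trans (+-identityˡ _) (trans (const-*ˡ c (q ^ₛ suc i) (suc i)) (trans (*-congˡ top) (*-identityʳ c))))
    where
    top : (q ^ₛ suc i) (suc i) ≈ 1#
    top = trans (S.sym (S.*-identityʳ (q ^ₛ suc i)) (suc i)) (≡.subst (λ k → (q ^ₛ suc i *ₛ oneS) k ≈ 1#) (ℕₚ.+-identityʳ (suc i)) (q^*-shift (suc i) oneS 0))
  ...   | no N≢i = sym (+-cong-zeroʳ (supportedAt-1 N N≢0) (trans (const-*ˡ c (q ^ₛ suc i) N) (trans (*-congˡ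
            (supportedAt-^ supportedAt-q (suc i) N (λ e → N≢i (≡.trans e (ℕₚ.*-identityʳ (suc i)))))) (zeroʳ c))))

  -- Together with the initial coefficients in `geomInv-small`, this is g = 1 + c q^(i+1) g read
  -- coefficient by coefficient.
  geomInv-shift : ∀ c i n → geomInv c i (suc i ℕ.+ n) ≈ c * geomInv c i n
  geomInv-shift c i n with (suc i ℕ.+ n) ℕ.% suc i ℕ.≟ 0 | n ℕ.% suc i ℕ.≟ 0
  ... | yes _ | yes _ = reflexive (≡.cong (powA c) (quotient))
    where
    quotient : (suc i ℕ.+ n) ℕ./ suc i ≡ suc (n ℕ./ suc i)
    quotient = ≡.trans (DivMod.m/n≡1+[m∸n]/n (ℕₚ.m≤m+n (suc i) n)) (≡.cong (λ k → suc (k ℕ./ suc i)) (ℕₚ.m+n∸m≡n (suc i) n))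
  ... | no _  | no _  = sym (zeroʳ c)
  ... | yes p | no ¬p = ⊥-elim (¬p (≡.trans (≡.sym (DivMod.[m+n]%n≡m%n n (suc i))) (≡.trans (≡.cong (ℕ._% suc i) (ℕₚ.+-comm n (suc i))) p)))
  ... | no ¬p | yes p = ⊥-elim (¬p (≡.trans (≡.cong (ℕ._% suc i) (ℕₚ.+-comm (suc i) n)) (≡.trans (DivMod.[m+n]%n≡m%n n (suc i)) p)))

  geomInv-small : ∀ c i n → n < suc i → geomInv c i n ≈ oneS n
  geomInv-small c i n n<s with n ℕ.% suc i ℕ.≟ 0
  geomInv-small c i zero    n<s | yes p = reflexive (≡.cong (powA c) (DivMod.0/n≡0 (suc i)))
  geomInv-small c i (suc n) n<s | yes p = ⊥-elim (ℕₚ.1+n≢0 (≡.trans (≡.sym (DivMod.m<n⇒m%n≡m n<s)) p))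
  geomInv-small c i zero    n<s | no ¬p = ⊥-elim (¬p (DivMod.m<n⇒m%n≡m n<s))
  geomInv-small c i (suc n) n<s | no ¬p = refl

  oneMinus : Carrier → ℕ → PS
  oneMinus c i = S.1# -ₛ const c *ₛ q ^ₛ suc i

  geomInv-inverse : ∀ c i → oneMinus c i *ₛ geomInv c i S.≈ S.1#
  geomInv-inverse c i N = trans
    (S.solve 3 (λ a b g → (S.𝟙 S.:- a S.:* b) S.:* g S.:= g S.:- a S.:* (b S.:* g)) S.refl (const c) (q ^ₛ s) g N)
    (trans (+-congˡ (-‿cong (const-*ˡ c (q ^ₛ s *ₛ g) N))) pointwise)
    where
    s = suc i
    g = geomInv c i
    pointwise : g N - c * (q ^ₛ s *ₛ g) N ≈ oneS N
    pointwise with N ℕ.<? s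
    ... | yes N<s = trans (+-cong (geomInv-small c i N N<s) (-‿cong (*-congˡ (q^*-vanish s g N N<s))))
            (solve 2 (λ x c → x :- c :* con (+ 0) := x) refl (oneS N) c)
    ... | no N≮s with N ℕ.∸ s | ℕₚ.m+[n∸m]≡n (ℕₚ.≮⇒≥ N≮s)
    ...   | n | ≡.refl = trans (+-cong (geomInv-shift c i n) (-‿cong (*-congˡ (q^*-shift s g n))))
            (-‿inverseʳ _)

  geomInv-cong : ∀ {c d} i → c ≈ d → geomInv c i S.≈ geomInv d i
  geomInv-cong {c} {d} i e N with N ℕ.% suc i ℕ.≟ 0
  ... | yes _ = ≡.subst₂ _≈_ (≡.sym (powA≈^ c k)) (≡.sym (powA≈^ d k)) (^-congˡ k e)
    where k = N ℕ./ suc i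
  ... | no _  = refl

  onePlus-cong : ∀ {c d} i → c ≈ d → onePlus c i S.≈ onePlus d i
  onePlus-cong i e N with N ℕ.≟ 0
  ... | yes _ = refl
  ... | no _ with N ℕ.≟ suc i
  ...   | yes _ = e
  ...   | no _ = refl

  -- The substitution q ↦ y q, a ring endomorphism of the power series.
  scale : Carrier → PS → PS
  scale y f n = y ^ n * f n

  scale-cong : ∀ y {f g} → f S.≈ g → scale y f S.≈ scale y g
  scale-cong y e n = *-congˡ (e n)

  scale-* : ∀ y f g → scale y (f *ₛ g) S.≈ scale y f *ₛ scale y g
  scale-* y f g zero    = solve 2 (λ a b → 𝟙 :* (a :* b) := 𝟙 :* a :* (𝟙 :* b)) refl _ _
  scale-* y f g (suc n) = trans
    (solve 5 (λ y Y a b c → y :* Y :* (a :* b :+ c) := 𝟙 :* a :* (y :* Y :* b) :+ y :* (Y :* c)) refl y (y ^ n) _ _ _)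
    (+-congˡ (trans (*-congˡ (scale-* y (f ∘ suc) g n))
      (trans (sym (conv-*ˡ y (scale y (f ∘ suc)) (scale y g) n)) (conv-cong (λ i → sym (*-assoc _ _ _)) (λ _ → refl) n))))

  scale-1 : ∀ y → scale y S.1# S.≈ S.1#
  scale-1 y zero    = *-identityˡ 1#
  scale-1 y (suc n) = zeroʳ _

  scale-∏ : ∀ y n F → scale y (S.∏ n F) S.≈ S.∏ n (scale y ∘ F)
  scale-∏ y zero    F = scale-1 y
  scale-∏ y (suc n) F = S.trans (scale-* y (S.∏ n F) (F n)) (S.*-congʳ (scale-∏ y n F))

  scale-^ : ∀ y f n → scale y (f ^ₛ n) S.≈ scale y f ^ₛ n
  scale-^ y f zero    = scale-1 y
  scale-^ y f (suc n) = S.trans (scale-* y f (f ^ₛ n)) (S.*-congˡ {scale y f} (scale-^ y f n))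

  scale-geomInv : ∀ y c i → scale y (geomInv c i) S.≈ geomInv (y ^ suc i * c) i
  scale-geomInv y c i N with N ℕ.% suc i ℕ.≟ 0
  ... | no _  = zeroʳ _
  ... | yes p = trans (*-cong (^-congʳ y (≡.trans (DivMod.m≡m%n+[m/n]*n N s) (≡.trans (≡.cong (ℕ._+ k ℕ.* s) p) (ℕₚ.*-comm k s)))) (reflexive (powA≈^ c k)))
    (trans (*-congʳ (sym (^-assocʳ y s k))) (trans (sym (^-distrib-* (y ^ s) c k)) (reflexive (≡.sym (powA≈^ _ k)))))
    where
    s = suc i
    k = N ℕ./ s

  powS≈^ : ∀ f n → powS f n S.≈ f ^ₛ n
  powS≈^ f zero    = S.refl
  powS≈^ f (suc n) = S.trans (*S≈conv f (powS f n)) (S.*-congˡ {f} (powS≈^ f n))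

  prodS-applyUpTo : ∀ F n → prodS (applyUpTo F n) S.≈ S.∏ n F
  prodS-applyUpTo F zero    = S.refl
  prodS-applyUpTo F (suc n) = S.trans (*S≈conv (F 0) _) (S.trans (S.*-congˡ {F 0} (prodS-applyUpTo (F ∘ suc) n)) (S.sym (S.∏-sucˡ n F)))

  infProd≈∏ : ∀ F N → infProd F N ≈ S.∏ N F N
  infProd≈∏ F N = trans (reflexive (≡.cong (λ fs → prodS fs N) (map-upTo F N))) (prodS-applyUpTo F N N)

  prodS₃ : ∀ f g k → prodS (f ∷ g ∷ k ∷ []) S.≈ f *ₛ (g *ₛ k)
  prodS₃ f g k = S.trans (*S≈conv f _) (S.*-congˡ {f} (S.trans (*S≈conv g _) (S.*-congˡ {g} (S.trans (*S≈conv k oneS) (S.*-identityʳ k)))))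

  1^n≈1 : ∀ n → 1# ^ n ≈ 1#
  1^n≈1 zero    = refl
  1^n≈1 (suc n) = trans (*-identityˡ _) (1^n≈1 n)

-- The crank series with ζ and ζ⁻¹ specialised in a ring.

module CrankSeries (K : CommutativeRing 0ℓ 0ℓ) (ω ω⁻¹ : CommutativeRing.Carrier K) (ℓ m : ℕ) where

  open CommutativeRing K
  open PowerSeries K
  open Algebra.Properties.CommutativeSemiring.Exp commutativeSemiring

  odds : List ℕ
  odds = map (λ t → 1 ℕ.+ 2 ℕ.* t) (upTo ((ℓ ℕ.∸ 3) ℕ./ 2))

  numerator centralDenominator outerDenominator crankFactor : ℕ → PS
  numerator i = prodS (onePlus 1# i ∷ onePlus (ω ^ (ℓ ℕ.∸ 2)) i ∷ onePlus (ω⁻¹ ^ (ℓ ℕ.∸ 2)) i ∷ [])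
  centralDenominator i = prodS (geomInv 1# i ∷ geomInv (ω ^ (ℓ ℕ.∸ 2)) i ∷ geomInv (ω⁻¹ ^ (ℓ ℕ.∸ 2)) i ∷ [])
  outerDenominator i = prodS (map (λ a → geomInv (ω ^ a) i *S geomInv (ω⁻¹ ^ a) i) odds)
  crankFactor i = numerator i *S powS (centralDenominator i) m *S powS (outerDenominator i) (suc m)

  crankSeries : PS
  crankSeries = infProd crankFactor

-- The properties of ω from which the vanishing is derived. `torsionFree` is injectivity of
-- multiplication by ℓ, with ℓ x written as a sum of ℓ copies of x.
record CyclotomicRoot (K : CommutativeRing 0ℓ 0ℓ) (ω : CommutativeRing.Carrier K) (ℓ : ℕ) : Set where
  open CommutativeRing K
  open FiniteProducts K
  open Algebra.Properties.CommutativeSemiring.Exp commutativeSemiring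
  field
    ∑ω≈0        : ∑ ℓ (ω ^_) ≈ 0#
    torsionFree : ∀ x → ∑ ℓ (λ _ → x) ≈ 0# → x ≈ 0#

module CrankFactor (K : CommutativeRing 0ℓ 0ℓ) (ω ω⁻¹ : CommutativeRing.Carrier K) (h m : ℕ) where

  open CommutativeRing K
  open PowerSeries K
  open PowerSeriesProperties K
  open S using () renaming (_*_ to _*ₛ_; _^_ to _^ₛ_)
  open Algebra.Properties.CommutativeSemiring.Exp commutativeSemiring
  open CrankSeries K ω ω⁻¹ (3 ℕ.+ 2 ℕ.* h) m

  outerPair : ℕ → ℕ → PS
  outerPair i t = geomInv (ω ^ (1 ℕ.+ 2 ℕ.* t)) i *ₛ geomInv (ω⁻¹ ^ (1 ℕ.+ 2 ℕ.* t)) i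

  outerDenominator≈ : ∀ i → outerDenominator i S.≈ S.∏ h (outerPair i)
  outerDenominator≈ i = S.trans
    (S.reflexive (≡.cong prodS (≡.trans
      (≡.cong (map pair) (≡.trans (map-upTo _ _) (≡.cong (applyUpTo _) (≡.trans (≡.cong (ℕ._/ 2) (ℕₚ.*-comm 2 h)) (DivMod.m*n/n≡m h 2)))))
      (map-applyUpTo _ pair h))))
    (S.trans (prodS-applyUpTo _ h) (S.∏-cong h (λ t _ → *S≈conv (geomInv (ω ^ (1 ℕ.+ 2 ℕ.* t)) i) _)))
    where
    pair : ℕ → PS
    pair a = geomInv (ω ^ a) i *S geomInv (ω⁻¹ ^ a) i

  crankFactor-cong : ∀ i {X Y Z} → numerator i S.≈ X → centralDenominator i S.≈ Y → outerDenominator i S.≈ Z →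
    crankFactor i S.≈ X *ₛ Y ^ₛ m *ₛ Z ^ₛ suc m
  crankFactor-cong i X≈ Y≈ Z≈ = S.trans (*S≈conv (numerator i *S powS (centralDenominator i) m) _)
    (S.*-cong (S.trans (*S≈conv (numerator i) _) (S.*-cong X≈ (S.trans (powS≈^ (centralDenominator i) m) (S.^-congˡ m Y≈))))
      (S.trans (powS≈^ (outerDenominator i) (suc m)) (S.^-congˡ (suc m) Z≈)))

-- Vanishing of crank coefficients at an ℓ-th root of unity.

module RootOfUnity (K : CommutativeRing 0ℓ 0ℓ) (ω : CommutativeRing.Carrier K) (h m : ℕ)
  (ℓ-prime : Prime (3 ℕ.+ 2 ℕ.* h)) (ω-cyclotomic : CyclotomicRoot K ω (3 ℕ.+ 2 ℕ.* h)) where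

  open CommutativeRing K
  open FiniteProducts K
  open Algebra.Properties.CommutativeSemiring.Exp commutativeSemiring
  open CyclotomicRoot ω-cyclotomic
  open IntegerCoefficients K
  open PowerSeries K
  open PowerSeriesProperties K
  open S using () renaming (_*_ to _*ₛ_; _^_ to _^ₛ_; _+_ to _+ₛ_; _-_ to _-ₛ_)

  ℓ : ℕ
  ℓ = 3 ℕ.+ 2 ℕ.* h

  -- The exponent is ℓ - 1, so that `ω * ω⁻¹` unfolds to `ω ^ ℓ`.
  ω⁻¹ : Carrier
  ω⁻¹ = ω ^ (2 ℕ.+ 2 ℕ.* h)

  open CrankSeries K ω ω⁻¹ (3 ℕ.+ 2 ℕ.* h) m
  open CrankFactor K ω ω⁻¹ h m

  geometricSum : ∀ n → (ω - 1#) * ∑ n (ω ^_) ≈ ω ^ n - 1#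
  geometricSum zero    = solve 1 (λ w → (w :- 𝟙) :* con (+ 0) := 𝟙 :- 𝟙) refl ω
  geometricSum (suc n) = trans (distribˡ _ _ _) (trans (+-congʳ (geometricSum n))
    (solve 2 (λ w W → (W :- 𝟙) :+ (w :- 𝟙) :* W := w :* W :- 𝟙) refl ω (ω ^ n)))

  ω^ℓ≈1 : ω ^ ℓ ≈ 1#
  ω^ℓ≈1 = trans (solve 1 (λ x → x := (x :- 𝟙) :+ 𝟙) refl (ω ^ ℓ))
    (trans (+-congʳ (trans (sym (geometricSum ℓ)) (trans (*-congˡ ∑ω≈0) (zeroʳ _)))) (+-identityˡ 1#))

  ω^-multiple : ∀ k → ω ^ (k ℕ.* ℓ) ≈ 1#
  ω^-multiple zero    = refl
  ω^-multiple (suc k) = trans (^-homo-* ω ℓ (k ℕ.* ℓ)) (trans (*-cong ω^ℓ≈1 (ω^-multiple k)) (*-identityˡ 1#))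

  ω^*ω⁻¹^ : ∀ n → ω ^ n * ω⁻¹ ^ n ≈ 1#
  ω^*ω⁻¹^ n = trans (sym (^-distrib-* ω ω⁻¹ n)) (trans (^-congˡ n ω^ℓ≈1) (1^n≈1 n))

  fixed-^ : ∀ z x → z * x ≈ x → ∀ n → z ^ n * x ≈ x
  fixed-^ z x e zero    = *-identityˡ x
  fixed-^ z x e (suc n) = trans (*-assoc _ _ _) (trans (*-congˡ (fixed-^ z x e n)) e)

  -- Each ω^i fixes x, hence ℓ x = (Σ ω^i) x = 0.
  fixed-by-ω⇒0 : ∀ x → ω * x ≈ x → x ≈ 0#
  fixed-by-ω⇒0 x e = torsionFree x (trans (∑-cong ℓ (λ i _ → sym (trans (*-comm _ _) (fixed-^ ω x e i))))
    (trans (sym (*-distribˡ-∑ ℓ x (ω ^_))) (trans (*-congˡ ∑ω≈0) (zeroʳ x))))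

  ∤⇒coprime : ∀ n → ¬ ℓ ∣ n → Coprime n ℓ
  ∤⇒coprime n ℓ∤n (d∣n , d∣ℓ) with prime⇒irreducible ℓ-prime d∣ℓ
  ... | inj₁ d≡1    = d≡1
  ... | inj₂ ≡.refl = ⊥-elim (ℓ∤n d∣n)

  -- Bézout makes either ω or its inverse a power of ω^n, according to the sign of the relation, so
  -- being fixed by ω^n implies being fixed by ω.
  fixed-by-ω^⇒0 : ∀ n x → ¬ ℓ ∣ n → ω ^ n * x ≈ x → x ≈ 0#
  fixed-by-ω^⇒0 n x ℓ∤n e with coprime-Bézout (∤⇒coprime n ℓ∤n)
  ... | Bézout.+- a b eq = fixed-by-ω⇒0 x (trans (*-congʳ ω≈) fixed)
    where
    fixed : ω ^ (a ℕ.* n) * x ≈ x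
    fixed = trans (*-congʳ (trans (^-congʳ ω (ℕₚ.*-comm a n)) (sym (^-assocʳ ω n a)))) (fixed-^ (ω ^ n) x e a)
    ω≈ : ω ≈ ω ^ (a ℕ.* n)
    ω≈ = trans (trans (sym (*-identityʳ ω)) (*-congˡ (sym (ω^-multiple b)))) (^-congʳ ω eq)
  ... | Bézout.-+ a b eq = fixed-by-ω⇒0 x (trans (*-congˡ (sym fixed)) (trans (sym (*-assoc _ _ _)) (trans (*-congʳ one) (*-identityˡ x))))
    where
    fixed : ω ^ (a ℕ.* n) * x ≈ x
    fixed = trans (*-congʳ (trans (^-congʳ ω (ℕₚ.*-comm a n)) (sym (^-assocʳ ω n a)))) (fixed-^ (ω ^ n) x e a)
    one : ω * ω ^ (a ℕ.* n) ≈ 1#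
    one = trans (^-congʳ ω eq) (ω^-multiple b)

  y : Carrier
  y = ω ^ 2

  y^≈ : ∀ n → y ^ n ≈ ω ^ (2 ℕ.* n)
  y^≈ n = ^-assocʳ ω 2 n

  y^ℓ≈1 : y ^ ℓ ≈ 1#
  y^ℓ≈1 = trans (y^≈ ℓ) (ω^-multiple 2)

  fixed-by-y^⇒0 : ∀ n x → ¬ ℓ ∣ n → y ^ n * x ≈ x → x ≈ 0#
  fixed-by-y^⇒0 n x ℓ∤n e = fixed-by-ω^⇒0 (2 ℕ.* n) x ℓ∤2n (trans (*-congʳ (sym (y^≈ n))) e)
    where
    ℓ∤2n : ¬ ℓ ∣ 2 ℕ.* n
    ℓ∤2n d with euclidsLemma 2 n ℓ-prime d
    ... | inj₁ ℓ∣2 = ℕₚ.<⇒≱ (s≤s (s≤s (s≤s z≤n))) (ℕ∣.∣⇒≤ ℓ∣2)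
    ... | inj₂ ℓ∣n = ℓ∤n ℓ∣n

  inverse-unique : ∀ {a b c} → a * b ≈ 1# → a * c ≈ 1# → b ≈ c
  inverse-unique {a} {b} {c} p r = trans (sym (trans (*-congʳ r) (*-identityˡ b)))
    (trans (solve 3 (λ a b c → a :* c :* b := a :* b :* c) refl a b c) (trans (*-congʳ p) (*-identityˡ c)))

  -- As ℓ is odd, adding it to an odd exponent gives an even one. For 0 ≤ t ≤ h the positive odd
  -- exponents give y^(h+2), ..., y^(2h+2), and the negative ones give y^(h+1), ..., y.
  ω^odd : ∀ t → ω ^ (1 ℕ.+ 2 ℕ.* t) ≈ y ^ (suc h ℕ.+ suc t)
  ω^odd t = sym (trans (y^≈ (suc h ℕ.+ suc t)) (trans (^-congʳ ω (exponent h t)) (trans (^-homo-* ω ℓ _) (trans (*-congʳ ω^ℓ≈1) (*-identityˡ _)))))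
    where
    exponent : ∀ h t → 2 ℕ.* (suc h ℕ.+ suc t) ≡ (3 ℕ.+ 2 ℕ.* h) ℕ.+ (1 ℕ.+ 2 ℕ.* t)
    exponent = solve-∀

  ω⁻¹^odd : ∀ s t → s ℕ.+ t ≡ h → ω⁻¹ ^ (1 ℕ.+ 2 ℕ.* t) ≈ y ^ suc s
  ω⁻¹^odd s t ≡.refl = inverse-unique (ω^*ω⁻¹^ (1 ℕ.+ 2 ℕ.* t)) (trans (*-congˡ (y^≈ (suc s)))
    (trans (sym (^-homo-* ω (1 ℕ.+ 2 ℕ.* t) _)) (trans (^-congʳ ω (exponent s t)) ω^ℓ≈1)))
    where
    exponent : ∀ s t → (1 ℕ.+ 2 ℕ.* t) ℕ.+ 2 ℕ.* suc s ≡ 3 ℕ.+ 2 ℕ.* (s ℕ.+ t)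
    exponent = solve-∀

  -- Modulo ℓ, the exponents 0, ±1, ±3, …, ±(ℓ - 2) are the residues 2j, 0 ≤ j < ℓ.
  denominator : ℕ → PS
  denominator i = geomInv 1# i *ₛ S.∏ (suc h) (outerPair i)

  ∏-reverse : ∀ n (F : ℕ → PS) → S.∏ n (λ t → F (n ℕ.∸ suc t)) S.≈ S.∏ n F
  ∏-reverse zero    F = S.refl
  ∏-reverse (suc n) F = S.trans (S.∏-sucˡ n _) (S.trans (S.*-comm (F n) _) (S.*-congʳ (∏-reverse n F)))

  denominator≈ : ∀ i → denominator i S.≈ S.∏ ℓ (λ j → geomInv (y ^ j) i)
  denominator≈ i = S.trans (S.*-congˡ {G 0} rearrange) (S.trans (S.sym (S.∏-sucˡ (suc h ℕ.+ suc h) G))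
    (S.reflexive (≡.cong (λ k → S.∏ k G) (count h))))
    where
    G : ℕ → PS
    G j = geomInv (y ^ j) i
    count : ∀ h → suc (suc h ℕ.+ suc h) ≡ 3 ℕ.+ 2 ℕ.* h
    count = solve-∀
    rearrange : S.∏ (suc h) (outerPair i) S.≈ S.∏ (suc h ℕ.+ suc h) (G ∘ suc)
    rearrange =
      S.trans (S.∏-* (suc h) (λ t → geomInv (ω ^ (1 ℕ.+ 2 ℕ.* t)) i) _)
      (S.trans (S.*-cong
        (S.∏-cong (suc h) (λ t _ → S.trans (geomInv-cong i (ω^odd t)) (S.reflexive (≡.cong G (ℕₚ.+-suc (suc h) t)))))
        (S.trans (S.∏-cong (suc h) (λ t t≤h → geomInv-cong i (ω⁻¹^odd (h ℕ.∸ t) t (ℕₚ.m∸n+n≡m (ℕₚ.≤-pred t≤h)))))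
          -- For the negative exponents the power of y falls from h + 1 to 1 as t grows.
          (∏-reverse (suc h) (G ∘ suc))))
      (S.trans (S.*-comm (S.∏ (suc h) (λ t → G (suc (suc h ℕ.+ t)))) _) (S.sym (S.∏-+ (suc h) (suc h) (G ∘ suc)))))

  ∏-rotate : ∀ n (F : ℕ → PS) → F (suc n) S.≈ F 0 → S.∏ (suc n) (F ∘ suc) S.≈ S.∏ (suc n) F
  ∏-rotate n F e = S.trans (S.*-congˡ {S.∏ n (F ∘ suc)} e) (S.trans (S.*-comm (S.∏ n (F ∘ suc)) (F 0)) (S.sym (S.∏-sucˡ n F)))

  denominator-rotate : ∀ i c → S.∏ ℓ (λ j → geomInv (y ^ (c ℕ.+ j)) i) S.≈ S.∏ ℓ (λ j → geomInv (y ^ j) i)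
  denominator-rotate i zero    = S.refl
  denominator-rotate i (suc c) = S.trans
    (S.∏-cong ℓ (λ j _ → geomInv-cong i (^-congʳ y (≡.sym (ℕₚ.+-suc c j)))))
    (S.trans (∏-rotate (2 ℕ.+ 2 ℕ.* h) (λ j → geomInv (y ^ (c ℕ.+ j)) i) (geomInv-cong i periodic)) (denominator-rotate i c))
    where
    periodic : y ^ (c ℕ.+ ℓ) ≈ y ^ (c ℕ.+ 0)
    periodic = trans (^-homo-* y c ℓ) (trans (*-congˡ y^ℓ≈1) (sym (^-homo-* y c 0)))

  -- The substitution q ↦ y q multiplies each root y^j in the factor by y^(i+1), which only shifts j
  -- cyclically by i + 1.
  scale-denominator : ∀ i → scale y (denominator i) S.≈ denominator i
  scale-denominator i = S.trans (scale-cong y (denominator≈ i)) (S.trans (scale-∏ y ℓ _)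
    (S.trans (S.∏-cong ℓ (λ j _ → S.trans (scale-geomInv y (y ^ j) i) (geomInv-cong i (sym (^-homo-* y (suc i) j)))))
    (S.trans (denominator-rotate i (suc i)) (S.sym (denominator≈ i)))))

  denominatorPower : ℕ → PS
  denominatorPower N = S.∏ N (λ i → denominator i ^ₛ suc m)

  denominatorPower-vanish : ∀ N n → ¬ ℓ ∣ n → denominatorPower N n ≈ 0#
  denominatorPower-vanish N n ℓ∤n = fixed-by-y^⇒0 n _ ℓ∤n (invariant n)
    where
    invariant : scale y (denominatorPower N) S.≈ denominatorPower N
    invariant = S.trans (scale-∏ y N _) (S.∏-cong N (λ i _ → S.trans (scale-^ y (denominator i) (suc m)) (S.^-congˡ (suc m) (scale-denominator i))))

  -- Here x = a² and x⁻¹ = b², so t = x + x⁻¹. The base of the triple product is q², because the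
  -- numerators become differences of squares.
  a b t Q : PS
  a = const (ω ^ (1 ℕ.+ 2 ℕ.* h))
  b = const (ω⁻¹ ^ (1 ℕ.+ 2 ℕ.* h))
  t = a *ₛ a +ₛ b *ₛ b
  Q = q *ₛ q

  module J = JacobiTripleProduct powerSeries t Q

  const-1 : const 1# S.≈ S.1#
  const-1 zero    = refl
  const-1 (suc _) = refl

  a*b≈1 : a *ₛ b S.≈ S.1#
  a*b≈1 = S.trans (const-* (ω ^ (1 ℕ.+ 2 ℕ.* h)) _) (S.trans (λ { zero → ω^*ω⁻¹^ (1 ℕ.+ 2 ℕ.* h) ; (suc n) → refl }) const-1)

  jacobiFactor : ℕ → PS
  jacobiFactor i = (S.1# -ₛ Q ^ₛ suc i) *ₛ J.quadratic i

  -- Inserting W Y = 1 serves both sides. W completes the numerator X to differences of squares, and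
  -- Y raises the exponent of the central denominators from m to m + 1, that of the outer ones, so
  -- that all of them merge into `denominator`.
  crankFactor≈ : ∀ i → crankFactor i S.≈ jacobiFactor i *ₛ denominator i ^ₛ suc m
  crankFactor≈ i = begin
    crankFactor i
      ≈⟨ crankFactor-cong i X≈ Y≈ (outerDenominator≈ i) ⟩
    X *ₛ Y ^ₛ m *ₛ Z ^ₛ suc m
      ≈⟨ S.*-congʳ {Z ^ₛ suc m} (S.*-congʳ {Y ^ₛ m} (S.trans (S.sym (S.*-identityʳ X)) (S.*-congˡ {X} (S.sym WY≈1)))) ⟩
    X *ₛ (W *ₛ Y) *ₛ Y ^ₛ m *ₛ Z ^ₛ suc m
      ≈⟨ S.solve 5 (λ X W Y Ym Zm → X S.:* (W S.:* Y) S.:* Ym S.:* Zm S.:= X S.:* W S.:* (Y S.:* Ym S.:* Zm)) S.refl X W Y (Y ^ₛ m) (Z ^ₛ suc m) ⟩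
    X *ₛ W *ₛ (Y ^ₛ suc m *ₛ Z ^ₛ suc m)
      ≈⟨ S.*-cong XW≈ (S.trans (S.sym (S.^-distrib-* Y Z (suc m))) (S.^-congˡ (suc m) YZ≈)) ⟩
    jacobiFactor i *ₛ denominator i ^ₛ suc m ∎
    where
    open Relation.Binary.Reasoning.Setoid S.setoid
    e = 1 ℕ.+ 2 ℕ.* h
    u = q ^ₛ suc i
    g₁ = geomInv 1# i
    g₂ = geomInv (ω ^ e) i
    g₃ = geomInv (ω⁻¹ ^ e) i
    X = (S.1# +ₛ u) *ₛ ((S.1# +ₛ a *ₛ u) *ₛ (S.1# +ₛ b *ₛ u))
    W = (S.1# -ₛ u) *ₛ ((S.1# -ₛ a *ₛ u) *ₛ (S.1# -ₛ b *ₛ u))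
    Y = g₁ *ₛ (g₂ *ₛ g₃)
    Z = S.∏ h (outerPair i)
    const-1* : const 1# *ₛ u S.≈ u
    const-1* = S.trans (S.*-congʳ {u} const-1) (S.*-identityˡ u)
    X≈ : numerator i S.≈ X
    X≈ = S.trans (prodS₃ (onePlus 1# i) (onePlus (ω ^ e) i) (onePlus (ω⁻¹ ^ e) i)) (S.*-cong
      (S.trans (onePlus-expansion 1# i) (S.+-congˡ {S.1#} const-1*))
      (S.*-cong (onePlus-expansion (ω ^ e) i) (onePlus-expansion (ω⁻¹ ^ e) i)))
    Y≈ : centralDenominator i S.≈ Y
    Y≈ = prodS₃ g₁ g₂ g₃
    WY≈1 : W *ₛ Y S.≈ S.1#
    WY≈1 = S.trans (S.solve 6 (λ o₁ o₂ o₃ g₁ g₂ g₃ → o₁ S.:* (o₂ S.:* o₃) S.:* (g₁ S.:* (g₂ S.:* g₃)) S.:= o₁ S.:* g₁ S.:* (o₂ S.:* g₂ S.:* (o₃ S.:* g₃))) S.refl (S.1# -ₛ u) (oneMinus (ω ^ e) i) (oneMinus (ω⁻¹ ^ e) i) g₁ g₂ g₃)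
      (S.trans (S.*-cong
        (S.trans (S.*-congʳ {g₁} (S.+-congˡ {S.1#} (S.-‿cong (S.sym const-1*)))) (geomInv-inverse 1# i))
        (S.trans (S.*-cong (geomInv-inverse (ω ^ e) i) (geomInv-inverse (ω⁻¹ ^ e) i)) (S.*-identityˡ S.1#)))
        (S.*-identityˡ S.1#))
    YZ≈ : Y *ₛ Z S.≈ denominator i
    YZ≈ = S.solve 4 (λ g₁ g₂ g₃ Z → g₁ S.:* (g₂ S.:* g₃) S.:* Z S.:= g₁ S.:* (Z S.:* (g₂ S.:* g₃))) S.refl g₁ g₂ g₃ Z
    u²≈ : u *ₛ u S.≈ Q ^ₛ suc i
    u²≈ = S.sym (S.^-distrib-* q q (suc i))
    XW≈ : X *ₛ W S.≈ jacobiFactor i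
    XW≈ = S.trans
      -- The polynomial identity treats a and b as independent, so the factor (a b)² remains until
      -- `a*b≈1` removes it.
      (S.solve 3 (λ u a b →
        (S.𝟙 S.:+ u) S.:* ((S.𝟙 S.:+ a S.:* u) S.:* (S.𝟙 S.:+ b S.:* u)) S.:* ((S.𝟙 S.:- u) S.:* ((S.𝟙 S.:- a S.:* u) S.:* (S.𝟙 S.:- b S.:* u)))
        S.:= (S.𝟙 S.:- u S.:* u) S.:* (S.𝟙 S.:- (a S.:* a S.:+ b S.:* b) S.:* (u S.:* u) S.:+ (a S.:* b) S.:* (a S.:* b) S.:* ((u S.:* u) S.:* (u S.:* u)))) S.refl u a b)
      (S.*-cong (S.+-congˡ {S.1#} (S.-‿cong u²≈)) (S.+-cong (S.+-congˡ {S.1#} (S.-‿cong (S.*-congˡ {t} u²≈)))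
        (S.trans (S.*-cong (S.trans (S.*-cong a*b≈1 a*b≈1) (S.*-identityˡ S.1#)) (S.*-cong u²≈ u²≈)) (S.*-identityˡ _))))

  supportedAt-χ : ∀ r → J.χ r SupportedAt 0
  supportedAt-t : t SupportedAt 0
  supportedAt-t = supportedAt-+ (supportedAt-* (supportedAt-const _) (supportedAt-const _)) (supportedAt-* (supportedAt-const _) (supportedAt-const _))
  supportedAt-χ zero          = supportedAt-1
  supportedAt-χ (suc zero)    = supportedAt-+ supportedAt-t supportedAt-1
  supportedAt-χ (suc (suc r)) = supportedAt-+ (supportedAt-* supportedAt-t (supportedAt-χ (suc r))) (supportedAt-neg (supportedAt-χ r))

  supportedAt-Q^ : ∀ n → (Q ^ₛ n) SupportedAt (n ℕ.* 2)
  supportedAt-Q^ = supportedAt-^ (supportedAt-* supportedAt-q supportedAt-q)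

  supportedAt-sign : ∀ r → J.sign r SupportedAt (r ℕ.* suc r)
  supportedAt-sign zero    = supportedAt-1
  supportedAt-sign (suc r) = supportedAt-neg (≡.subst ((Q ^ₛ suc r *ₛ J.sign r) SupportedAt_) (exponent r) (supportedAt-* (supportedAt-Q^ (suc r)) (supportedAt-sign r)))
    where
    exponent : ∀ r → suc r ℕ.* 2 ℕ.+ r ℕ.* suc r ≡ suc r ℕ.* suc (suc r)
    exponent = solve-∀

  -- As Q = q², the theta terms sit in the degrees r(r+1), and the error of `J.jacobi` starts in
  -- degree 2N + 2, beyond n.
  jacobiProduct-vanish : ∀ N n → n ≤ N → (∀ r → n ≢ r ℕ.* suc r) → S.∏ N jacobiFactor n ≈ 0#
  jacobiProduct-vanish N n n≤N n≢ = trans (proj₂ (J.jacobi N) n) (trans (+-cong (theta (suc N)) tail) (+-identityˡ 0#))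
    where
    theta : ∀ k → S.∑ k (λ r → J.sign r *ₛ J.χ r) n ≈ 0#
    theta zero    = refl
    theta (suc k) = trans (+-cong (theta k) (supportedAt-* (supportedAt-sign k) (supportedAt-χ k) n (λ e → n≢ k (≡.trans e (ℕₚ.+-identityʳ _))))) (+-identityˡ 0#)
    tail : (Q ^ₛ suc N *ₛ proj₁ (J.jacobi N)) n ≈ 0#
    tail = conv-vanish (Q ^ₛ suc N) _ n (λ i j e → trans (*-congʳ (supportedAt-Q^ (suc N) i (λ i≡ → ℕₚ.<⇒≢
      (ℕₚ.≤-<-trans (ℕₚ.≤-trans (≡.subst (i ≤_) e (ℕₚ.m≤m+n i j)) n≤N) (ℕₚ.m≤m*n (suc N) 2)) i≡))) (zeroˡ _))

  crankSeries-vanish : ∀ N → (∀ s r → N ≢ s ℕ.* ℓ ℕ.+ r ℕ.* suc r) → crankSeries N ≈ 0#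
  crankSeries-vanish N N≢ = trans (infProd≈∏ crankFactor N) (trans (S.∏-cong N (λ i _ → crankFactor≈ i) N)
    (trans (S.∏-* N jacobiFactor (λ i → denominator i ^ₛ suc m) N)
    (conv-vanish (S.∏ N jacobiFactor) (denominatorPower N) N term)))
    where
    term : ∀ i j → i ℕ.+ j ≡ N → S.∏ N jacobiFactor i * denominatorPower N j ≈ 0#
    term i j e with ℓ ∣? j
    ... | no ℓ∤j = trans (*-congˡ (denominatorPower-vanish N j ℓ∤j)) (zeroʳ _)
    ... | yes (ℕ∣.divides s ≡.refl) = trans (*-congʳ (jacobiProduct-vanish N i (≡.subst (i ≤_) e (ℕₚ.m≤m+n i j))
            (λ { r ≡.refl → N≢ s r (≡.trans (≡.sym e) (ℕₚ.+-comm i j)) }))) (zeroˡ _)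

-- Evaluation of Laurent polynomials, carried through the series constructions.

module Horner (K : CommutativeRing 0ℓ 0ℓ) (ω : CommutativeRing.Carrier K) where

  open CommutativeRing K
  open IntegerCoefficients K
  open Algebra.Properties.CommutativeSemiring.Exp commutativeSemiring

  horner : List ℤ → Carrier
  horner []       = 0#
  horner (a ∷ as) = fromℤ a + ω * horner as

  horner-addL : ∀ as bs → horner (addL as bs) ≈ horner as + horner bs
  horner-addL []       bs       = sym (+-identityˡ _)
  horner-addL (a ∷ as) []       = sym (+-identityʳ _)
  horner-addL (a ∷ as) (b ∷ bs) = trans (+-cong (fromℤ-+ a b) (*-congˡ (horner-addL as bs)))
    (solve 5 (λ a b w x y → (a :+ b) :+ w :* (x :+ y) := (a :+ w :* x) :+ (b :+ w :* y)) refl _ _ ω _ _)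

  horner-map-* : ∀ a bs → horner (map (a ℤ.*_) bs) ≈ fromℤ a * horner bs
  horner-map-* a []       = sym (zeroʳ _)
  horner-map-* a (b ∷ bs) = trans (+-cong (fromℤ-* a b) (*-congˡ (horner-map-* a bs)))
    (solve 4 (λ a b w x → a :* b :+ w :* (a :* x) := a :* (b :+ w :* x)) refl _ _ ω _)

  horner-mulL : ∀ as bs → horner (mulL as bs) ≈ horner as * horner bs
  horner-mulL []       bs = sym (zeroˡ _)
  horner-mulL (a ∷ as) bs = trans (horner-addL (map (a ℤ.*_) bs) _)
    (trans (+-cong (horner-map-* a bs) (trans (+-identityˡ _) (*-congˡ (horner-mulL as bs))))
    (solve 4 (λ a x y w → a :* y :+ w :* (x :* y) := (a :+ w :* x) :* y) refl _ _ _ ω))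

  horner-shift : ∀ k as → horner (replicate k (+ 0) ++ as) ≈ ω ^ k * horner as
  horner-shift zero    as = sym (*-identityˡ _)
  horner-shift (suc k) as = trans (+-identityˡ _) (trans (*-congˡ (horner-shift k as)) (sym (*-assoc _ _ _)))

module Evaluation (K : CommutativeRing 0ℓ 0ℓ) (ω ω⁻¹ : CommutativeRing.Carrier K)
  (ω*ω⁻¹≈1 : CommutativeRing._≈_ K (CommutativeRing._*_ K ω ω⁻¹) (CommutativeRing.1# K)) where

  open CommutativeRing K
  open IntegerCoefficients K
  open PowerSeries K
  open Horner K ω public
  open Algebra.Properties.CommutativeSemiring.Exp commutativeSemiring

  ω^ℤ : ℤ → Carrier
  ω^ℤ (+ n)    = ω ^ n
  ω^ℤ -[1+ n ] = ω⁻¹ ^ suc n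

  ω^ℤ-⊖ : ∀ m n → ω^ℤ (m ℤ.⊖ n) ≈ ω ^ m * ω⁻¹ ^ n
  ω^ℤ-⊖ m       zero    = sym (*-identityʳ _)
  ω^ℤ-⊖ zero    (suc n) = sym (*-identityˡ _)
  ω^ℤ-⊖ (suc m) (suc n) = trans (reflexive (≡.cong ω^ℤ (ℤₚ.[1+m]⊖[1+n]≡m⊖n m n))) (trans (ω^ℤ-⊖ m n)
    (trans (sym (*-identityˡ _)) (trans (*-congʳ (sym ω*ω⁻¹≈1))
    (solve 4 (λ w v x y → w :* v :* (x :* y) := w :* x :* (v :* y)) refl ω ω⁻¹ _ _))))

  ω^ℤ-+ : ∀ i j → ω^ℤ (i ℤ.+ j) ≈ ω^ℤ i * ω^ℤ j
  ω^ℤ-+ (+ m)    (+ n)    = ^-homo-* ω m n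
  ω^ℤ-+ (+ m)    -[1+ n ] = ω^ℤ-⊖ m (suc n)
  ω^ℤ-+ -[1+ m ] (+ n)    = trans (ω^ℤ-⊖ n (suc m)) (*-comm _ _)
  ω^ℤ-+ -[1+ m ] -[1+ n ] = trans (^-congʳ ω⁻¹ (≡.cong suc (≡.sym (ℕₚ.+-suc m n)))) (^-homo-* ω⁻¹ (suc m) (suc n))

  ω^ℤ-neg : ∀ n → ω^ℤ (ℤ.- (+ n)) ≈ ω⁻¹ ^ n
  ω^ℤ-neg zero    = refl
  ω^ℤ-neg (suc n) = refl

  eval : LP → Carrier
  eval (mkLP l c) = ω^ℤ l * horner c

  -- The monomial prefactor is a unit with inverse `ω^ℤ (ℤ.- l)`.
  eval≈0⇒horner≈0 : ∀ l c → eval (mkLP l c) ≈ 0# → horner c ≈ 0#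
  eval≈0⇒horner≈0 l c e = trans (sym (*-identityˡ _)) (trans (*-congʳ unit) (trans (*-assoc _ _ _) (trans (*-congˡ e) (zeroʳ _))))
    where
    unit : 1# ≈ ω^ℤ (ℤ.- l) * ω^ℤ l
    unit = trans (reflexive (≡.cong ω^ℤ (≡.sym (ℤₚ.+-inverseˡ l)))) (ω^ℤ-+ (ℤ.- l) l)

  eval-addLP : ∀ f g → eval (addLP f g) ≈ eval f + eval g
  eval-addLP (mkLP l₁ c₁) (mkLP l₂ c₂) = trans (*-congˡ (trans (horner-addL (replicate ℤ.∣ l₁ ℤ.- l ∣ (+ 0) ++ c₁) _)
      (+-cong (horner-shift ℤ.∣ l₁ ℤ.- l ∣ c₁) (horner-shift ℤ.∣ l₂ ℤ.- l ∣ c₂))))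
    (trans (distribˡ _ _ _) (+-cong (realign (ℤₚ.i⊓j≤i l₁ l₂) c₁) (realign (ℤₚ.i⊓j≤j l₁ l₂) c₂)))
    where
    l = l₁ ℤ.⊓ l₂
    realign : ∀ {k} → l ℤ.≤ k → ∀ c → ω^ℤ l * (ω ^ ℤ.∣ k ℤ.- l ∣ * horner c) ≈ ω^ℤ k * horner c
    realign {k} l≤k c = trans (sym (*-assoc _ _ _)) (*-congʳ (trans (sym (ω^ℤ-+ l (+ ℤ.∣ k ℤ.- l ∣))) (reflexive (≡.cong ω^ℤ l+≡k))))
      where
      l+≡k : l ℤ.+ + ℤ.∣ k ℤ.- l ∣ ≡ k
      l+≡k = ≡.trans (≡.cong (λ x → l ℤ.+ x) (ℤₚ.0≤i⇒+∣i∣≡i (ℤₚ.i≤j⇒0≤j-i l≤k))) (≡.trans (ℤₚ.+-comm l _)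
        (≡.trans (ℤₚ.+-assoc k (ℤ.- l) l) (≡.trans (≡.cong (λ x → k ℤ.+ x) (ℤₚ.+-inverseˡ l)) (ℤₚ.+-identityʳ k))))

  eval-mulLP : ∀ f g → eval (mulLP f g) ≈ eval f * eval g
  eval-mulLP (mkLP l₁ c₁) (mkLP l₂ c₂) = trans (*-cong (ω^ℤ-+ l₁ l₂) (horner-mulL c₁ c₂))
    (solve 4 (λ a b c d → a :* b :* (c :* d) := a :* c :* (b :* d)) refl _ _ _ _)

  eval-zeroLP : eval zeroLP ≈ 0#
  eval-zeroLP = zeroʳ _

  eval-oneLP : eval oneLP ≈ 1#
  eval-oneLP = solve 1 (λ w → 𝟙 :* (𝟙 :+ w :* con (+ 0)) := 𝟙) refl ω

  eval-mono : ∀ i → eval (mono i) ≈ ω^ℤ i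
  eval-mono i = solve 2 (λ z w → z :* (𝟙 :+ w :* con (+ 0)) := z) refl (ω^ℤ i) ω

  -- A record rather than a function type, so that f and g can be inferred from f ~ g.
  infix 4 _~_
  record _~_ (f : SLP.PS) (g : PS) : Set where
    constructor coefficientwise
    field at : ∀ n → eval (f n) ≈ g n
  open _~_ public

  ~-oneS : SLP.oneS ~ oneS
  ~-oneS = coefficientwise λ { zero → eval-oneLP ; (suc n) → eval-zeroLP }

  ~-*S : ∀ {f f′ g g′} → f ~ f′ → g ~ g′ → f SLP.*S g ~ f′ *S g′
  ~-*S {f} {f′} {g} {g′} p q = coefficientwise λ n → go n (upTo (suc n))
    where
    go : ∀ n is → eval (foldr addLP zeroLP (map (λ i → mulLP (f i) (g (n ℕ.∸ i))) is)) ≈ foldr _+_ 0# (map (λ i → f′ i * g′ (n ℕ.∸ i)) is)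
    go n []       = eval-zeroLP
    go n (i ∷ is) = trans (eval-addLP (mulLP (f i) (g (n ℕ.∸ i))) _)
      (+-cong (trans (eval-mulLP (f i) (g (n ℕ.∸ i))) (*-cong (at p i) (at q (n ℕ.∸ i)))) (go n is))

  ~-powS : ∀ {f f′} → f ~ f′ → ∀ k → SLP.powS f k ~ powS f′ k
  ~-powS p zero    = ~-oneS
  ~-powS p (suc k) = ~-*S p (~-powS p k)

  ~-prodS : ∀ {A : Set} {F : A → SLP.PS} {F′ : A → PS} → (∀ x → F x ~ F′ x) → ∀ xs → SLP.prodS (map F xs) ~ prodS (map F′ xs)
  ~-prodS p []       = ~-oneS
  ~-prodS p (x ∷ xs) = ~-*S (p x) (~-prodS p xs)

  ~-prodS₃ : ∀ {f f′ g g′ k k′} → f ~ f′ → g ~ g′ → k ~ k′ → SLP.prodS (f ∷ g ∷ k ∷ []) ~ prodS (f′ ∷ g′ ∷ k′ ∷ [])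
  ~-prodS₃ p q r = ~-*S p (~-*S q (~-*S r ~-oneS))

  ~-onePlus : ∀ {c d} i → eval c ≈ d → SLP.onePlus c i ~ onePlus d i
  ~-onePlus {c} {d} i e = coefficientwise go
    where
    go : ∀ N → eval (SLP.onePlus c i N) ≈ onePlus d i N
    go N with N ℕ.≟ 0
    ... | yes _ = eval-oneLP
    ... | no _ with N ℕ.≟ suc i
    ...   | yes _ = e
    ...   | no _  = eval-zeroLP

  eval-powA : ∀ {c d} → eval c ≈ d → ∀ k → eval (SLP.powA c k) ≈ powA d k
  eval-powA e zero    = eval-oneLP
  eval-powA {c} e (suc k) = trans (eval-mulLP c (SLP.powA c k)) (*-cong e (eval-powA {c} e k))

  ~-geomInv : ∀ {c d} i → eval c ≈ d → SLP.geomInv c i ~ geomInv d i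
  ~-geomInv {c} {d} i e = coefficientwise go
    where
    go : ∀ N → eval (SLP.geomInv c i N) ≈ geomInv d i N
    go N with N ℕ.% suc i ℕ.≟ 0
    ... | yes _ = eval-powA {c} e (N ℕ./ suc i)
    ... | no _  = eval-zeroLP

  ~-infProd : ∀ {F : ℕ → SLP.PS} {F′ : ℕ → PS} → (∀ i → F i ~ F′ i) → SLP.infProd F ~ infProd F′
  ~-infProd p = coefficientwise λ N → at (~-prodS p (upTo N)) N

  module _ (ℓ m : ℕ) where
    open CrankSeries K ω ω⁻¹ ℓ m

    Cgen~crankSeries : Cgen ℓ m ~ crankSeries
    Cgen~crankSeries = ~-infProd (λ i → ~-*S (~-*S
        (~-prodS₃ (~-onePlus i eval-oneLP) (~-onePlus i (pos (ℓ ℕ.∸ 2))) (~-onePlus i (neg (ℓ ℕ.∸ 2))))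
        (~-powS (~-prodS₃ (~-geomInv i eval-oneLP) (~-geomInv i (pos (ℓ ℕ.∸ 2))) (~-geomInv i (neg (ℓ ℕ.∸ 2)))) m))
        (~-powS (~-prodS (λ a → ~-*S (~-geomInv i (pos a)) (~-geomInv i (neg a))) odds) (suc m)))
      where
      pos : ∀ a → eval (mono (+ a)) ≈ ω ^ a
      pos a = eval-mono (+ a)
      neg : ∀ a → eval (mono (ℤ.- (+ a))) ≈ ω⁻¹ ^ a
      neg a = trans (eval-mono (ℤ.- (+ a))) (ω^ℤ-neg a)

-- Specialisation at ζ = 1.

module AtOne where

  open IntegerCoefficients ℤₚ.+-*-commutativeRing
  open PowerSeries ℤₚ.+-*-commutativeRing
  open PowerSeriesProperties ℤₚ.+-*-commutativeRing
  open S using () renaming (_*_ to _*ₛ_; _^_ to _^ₛ_)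
  open Evaluation ℤₚ.+-*-commutativeRing (+ 1) (+ 1) ≡.refl public
  open Algebra.Properties.CommutativeSemiring.Exp (CommutativeRing.commutativeSemiring ℤₚ.+-*-commutativeRing)

  sumL : List ℤ → ℤ
  sumL = foldr ℤ._+_ (+ 0)

  fromℤ-id : ∀ i → fromℤ i ≡ i
  fromℤ-id (+ n)    = pos n
    where
    pos : ∀ n → fromℤ (+ n) ≡ + n
    pos zero          = ≡.refl
    pos (suc zero)    = ≡.refl
    pos (suc (suc n)) = ≡.trans (≡.cong (ℤ._+ + 1) (pos (suc n))) (≡.cong +_ (ℕₚ.+-comm (suc n) 1))
  fromℤ-id -[1+ n ] = ≡.cong ℤ.-_ (fromℤ-id (+ suc n))

  ω^ℤ≡1 : ∀ l → ω^ℤ l ≡ + 1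
  ω^ℤ≡1 (+ n)    = 1^n≈1 n
  ω^ℤ≡1 -[1+ n ] = 1^n≈1 (suc n)

  horner≡sumL : ∀ c → horner c ≡ sumL c
  horner≡sumL []       = ≡.refl
  horner≡sumL (a ∷ as) = ≡.cong₂ ℤ._+_ (fromℤ-id a) (≡.trans (ℤₚ.*-identityˡ _) (horner≡sumL as))

  -- A coefficient sum is the Horner value at 1, and Horner evaluation is multiplicative.
  sumL-mulL : ∀ as bs → sumL (mulL as bs) ≡ sumL as ℤ.* sumL bs
  sumL-mulL as bs = ≡.trans (≡.sym (horner≡sumL (mulL as bs))) (≡.trans (horner-mulL as bs) (≡.cong₂ ℤ._*_ (horner≡sumL as) (horner≡sumL bs)))

  eval≡evalAt1 : ∀ f → eval f ≡ evalAt1 f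
  eval≡evalAt1 (mkLP l c) = ≡.trans (≡.cong₂ ℤ._*_ (ω^ℤ≡1 l) (horner≡sumL c)) (ℤₚ.*-identityˡ _)

  ∏-const : ∀ n f → S.∏ n (λ _ → f) S.≈ f ^ₛ n
  ∏-const zero    f = S.refl
  ∏-const (suc n) f = S.trans (S.*-congʳ {f} (∏-const n f)) (S.*-comm (f ^ₛ n) f)

  -- At ζ = 1 the factor for q^n is (1 + q^n)^3 over (1 - q^n) to the power 3m + 2h(m+1), which
  -- equals ℓ m + (ℓ - 3) for ℓ = 3 + 2h.
  crankSeries≡pGen : ∀ h m N → CrankSeries.crankSeries ℤₚ.+-*-commutativeRing (+ 1) (+ 1) (3 ℕ.+ 2 ℕ.* h) m N ≡ pGen ((3 ℕ.+ 2 ℕ.* h) ℕ.* m ℕ.+ 2 ℕ.* h) 3 N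
  crankSeries≡pGen h m N = ≡.trans (infProd≈∏ crankFactor N) (≡.trans (S.∏-cong N (λ i _ → factor≈ i) N) (≡.sym (infProd≈∏ _ N)))
    where
    open CrankSeries ℤₚ.+-*-commutativeRing (+ 1) (+ 1) (3 ℕ.+ 2 ℕ.* h) m
    open CrankFactor ℤₚ.+-*-commutativeRing (+ 1) (+ 1) h m
    e = 1 ℕ.+ 2 ℕ.* h
    k = (3 ℕ.+ 2 ℕ.* h) ℕ.* m ℕ.+ 2 ℕ.* h
    exponent : ∀ h m → 3 ℕ.* m ℕ.+ 2 ℕ.* (h ℕ.* suc m) ≡ (3 ℕ.+ 2 ℕ.* h) ℕ.* m ℕ.+ 2 ℕ.* h
    exponent = solve-∀
    module _ (i : ℕ) where
      o g : PS
      o = onePlus (+ 1) i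
      g = geomInv (+ 1) i
      geomInv≈g : ∀ n → geomInv ((+ 1) ^ n) i S.≈ g
      geomInv≈g n = geomInv-cong i (1^n≈1 n)
      onePlus≈o : ∀ n → onePlus ((+ 1) ^ n) i S.≈ o
      onePlus≈o n = onePlus-cong i (1^n≈1 n)
      cube : ∀ f → f *ₛ (f *ₛ f) S.≈ f ^ₛ 3
      cube f = S.*-congˡ {f} (S.*-congˡ {f} (S.sym (S.*-identityʳ f)))
      numerator≈ : numerator i S.≈ o ^ₛ 3
      numerator≈ = S.trans (prodS₃ o (onePlus ((+ 1) ^ e) i) (onePlus ((+ 1) ^ e) i)) (S.trans (S.*-congˡ {o} (S.*-cong (onePlus≈o e) (onePlus≈o e))) (cube o))
      central≈ : centralDenominator i S.≈ g ^ₛ 3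
      central≈ = S.trans (prodS₃ g (geomInv ((+ 1) ^ e) i) (geomInv ((+ 1) ^ e) i)) (S.trans (S.*-congˡ {g} (S.*-cong (geomInv≈g e) (geomInv≈g e))) (cube g))
      outer≈ : outerDenominator i S.≈ g ^ₛ (2 ℕ.* h)
      outer≈ = S.trans (outerDenominator≈ i) (S.trans
        (S.∏-cong h (λ t _ → S.trans (S.*-cong (geomInv≈g (1 ℕ.+ 2 ℕ.* t)) (geomInv≈g (1 ℕ.+ 2 ℕ.* t))) (S.*-congˡ {g} (S.sym (S.*-identityʳ g)))))
        (S.trans (∏-const h (g ^ₛ 2)) (S.^-assocʳ g 2 h)))
      denominators≈ : (g ^ₛ 3) ^ₛ m *ₛ (g ^ₛ (2 ℕ.* h)) ^ₛ suc m S.≈ g ^ₛ k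
      denominators≈ = S.trans (S.*-cong (S.^-assocʳ g 3 m) (S.trans (S.^-assocʳ g (2 ℕ.* h) (suc m)) (S.^-congʳ g (ℕₚ.*-assoc 2 h (suc m)))))
        (S.trans (S.sym (S.^-homo-* g (3 ℕ.* m) (2 ℕ.* (h ℕ.* suc m)))) (S.^-congʳ g (exponent h m)))
      factor≈ : crankFactor i S.≈ SZ.powS (SZ.onePlus (+ 1) i) 3 SZ.*S SZ.powS (SZ.geomInv (+ 1) i) k
      factor≈ = S.trans (crankFactor-cong i numerator≈ central≈ outer≈)
        (S.trans (S.*-assoc (o ^ₛ 3) ((g ^ₛ 3) ^ₛ m) ((g ^ₛ (2 ℕ.* h)) ^ₛ suc m))
        (S.trans (S.*-cong {o ^ₛ 3} (S.sym (powS≈^ o 3)) (S.trans denominators≈ (S.sym (powS≈^ g k))))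
        (S.sym (*S≈conv (powS o 3) (powS g k)))))

-- The quotient of a ring by a principal ideal.

module Quotient (R : CommutativeRing 0ℓ 0ℓ) (d : CommutativeRing.Carrier R) where

  open CommutativeRing R
  open IntegerCoefficients R

  infix 4 _≈/_
  -- Congruence modulo d, carrying the cofactor as data: from a congruence to 0 modulo Φ the
  -- quotient by Φ can be read off.
  record _≈/_ (a b : Carrier) : Set where
    constructor multiple
    field
      factor   : Carrier
      equation : a ≈ b + d * factor

  ≈⇒≈/ : ∀ {a b} → a ≈ b → a ≈/ b
  ≈⇒≈/ e = multiple 0# (trans e (solve 2 (λ b d → b := b :+ d :* con (+ 0)) refl _ d))

  ≈/-sym : ∀ {a b} → a ≈/ b → b ≈/ a
  ≈/-sym {a} {b} (multiple h e) = multiple (- h) (trans (solve 3 (λ b d h → b := b :+ d :* h :+ d :* (:- h)) refl b d h) (+-congʳ (sym e)))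

  ≈/-trans : ∀ {a b c} → a ≈/ b → b ≈/ c → a ≈/ c
  ≈/-trans {a} {b} {c} (multiple h p) (multiple k q) = multiple (k + h) (trans p (trans (+-congʳ q)
    (solve 4 (λ c d h k → c :+ d :* k :+ d :* h := c :+ d :* (k :+ h)) refl c d h k)))

  +-cong/ : ∀ {a a′ b b′} → a ≈/ a′ → b ≈/ b′ → a + b ≈/ a′ + b′
  +-cong/ {a} {a′} {b} {b′} (multiple h p) (multiple k q) = multiple (h + k) (trans (+-cong p q)
    (solve 5 (λ a b d h k → (a :+ d :* h) :+ (b :+ d :* k) := (a :+ b) :+ d :* (h :+ k)) refl a′ b′ d h k))

  *-cong/ : ∀ {a a′ b b′} → a ≈/ a′ → b ≈/ b′ → a * b ≈/ a′ * b′
  *-cong/ {a} {a′} {b} {b′} (multiple h p) (multiple k q) = multiple (a′ * k + b′ * h + d * h * k) (trans (*-cong p q)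
    (solve 5 (λ a b d h k → (a :+ d :* h) :* (b :+ d :* k) := a :* b :+ d :* (a :* k :+ b :* h :+ d :* h :* k)) refl a′ b′ d h k))

  -‿cong/ : ∀ {a a′} → a ≈/ a′ → - a ≈/ - a′
  -‿cong/ {a} {a′} (multiple h p) = multiple (- h) (trans (-‿cong p) (solve 3 (λ a d h → :- (a :+ d :* h) := :- a :+ d :* (:- h)) refl a′ d h))

  quotient : CommutativeRing 0ℓ 0ℓ
  quotient = record
    { Carrier = Carrier
    ; _≈_ = _≈/_
    ; _+_ = _+_
    ; _*_ = _*_
    ; -_ = -_
    ; 0# = 0#
    ; 1# = 1#
    ; isCommutativeRing = record
      { isRing = record
        { +-isAbelianGroup = record
          { isGroup = record
            { isMonoid = record
              { isSemigroup = record
                { isMagma = record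
                  { isEquivalence = record { refl = ≈⇒≈/ refl ; sym = ≈/-sym ; trans = ≈/-trans }
                  ; ∙-cong = +-cong/ }
                ; assoc = λ a b c → ≈⇒≈/ (+-assoc a b c) }
              ; identity = (λ a → ≈⇒≈/ (+-identityˡ a)) , (λ a → ≈⇒≈/ (+-identityʳ a)) }
            ; inverse = (λ a → ≈⇒≈/ (-‿inverseˡ a)) , (λ a → ≈⇒≈/ (-‿inverseʳ a))
            ; ⁻¹-cong = -‿cong/ }
          ; comm = λ a b → ≈⇒≈/ (+-comm a b) }
        ; *-cong = *-cong/
        ; *-assoc = λ a b c → ≈⇒≈/ (*-assoc a b c)
        ; *-identity = (λ a → ≈⇒≈/ (*-identityˡ a)) , (λ a → ≈⇒≈/ (*-identityʳ a))
        ; distrib = (λ a b c → ≈⇒≈/ (distribˡ a b c)) , (λ a b c → ≈⇒≈/ (distribʳ a b c))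
        }
      ; *-comm = λ a b → ≈⇒≈/ (*-comm a b)
      }
    }

-- Integer polynomials as coefficient lists.

module IntegerPolynomials where

  open PowerSeries ℤₚ.+-*-commutativeRing
  open PowerSeriesProperties ℤₚ.+-*-commutativeRing using (module S)

  -- Lists that differ by trailing zeros denote the same polynomial.
  infix 4 _≈ₚ_
  _≈ₚ_ : List ℤ → List ℤ → Set
  as ≈ₚ bs = ∀ n → nthL as n ≡ nthL bs n

  nthL-addL : ∀ as bs n → nthL (addL as bs) n ≡ nthL as n ℤ.+ nthL bs n
  nthL-addL []       bs       n       = ≡.sym (ℤₚ.+-identityˡ _)
  nthL-addL (a ∷ as) []       n       = ≡.sym (ℤₚ.+-identityʳ _)
  nthL-addL (a ∷ as) (b ∷ bs) zero    = ≡.refl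
  nthL-addL (a ∷ as) (b ∷ bs) (suc n) = nthL-addL as bs n

  nthL-map : ∀ (f : ℤ → ℤ) → f (+ 0) ≡ + 0 → ∀ as n → nthL (map f as) n ≡ f (nthL as n)
  nthL-map f z []       n       = ≡.sym z
  nthL-map f z (a ∷ as) zero    = ≡.refl
  nthL-map f z (a ∷ as) (suc n) = nthL-map f z as n

  nthL-mulL : ∀ as bs n → nthL (mulL as bs) n ≡ conv (nthL as) (nthL bs) n
  nthL-mulL []       bs n       = ≡.sym (conv-zeroˡ (nthL []) (nthL bs) (λ _ → ≡.refl) n)
  nthL-mulL (a ∷ as) bs zero    = ≡.trans (nthL-addL (map (a ℤ.*_) bs) _ 0)
    (≡.trans (ℤₚ.+-identityʳ _) (nthL-map (a ℤ.*_) (ℤₚ.*-zeroʳ a) bs 0))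
  nthL-mulL (a ∷ as) bs (suc n) = ≡.trans (nthL-addL (map (a ℤ.*_) bs) _ (suc n))
    (≡.cong₂ ℤ._+_ (nthL-map (a ℤ.*_) (ℤₚ.*-zeroʳ a) bs (suc n)) (nthL-mulL as bs n))

  nthL-one : ∀ n → nthL (+ 1 ∷ []) n ≡ oneS n
  nthL-one zero    = ≡.refl
  nthL-one (suc n) = ≡.refl

  rawPolynomials : RawRing 0ℓ 0ℓ
  rawPolynomials = record
    { Carrier = List ℤ ; _≈_ = _≈ₚ_ ; _+_ = addL ; _*_ = mulL ; -_ = map (ℤ.-_) ; 0# = [] ; 1# = + 1 ∷ [] }

  open RingMorphisms rawPolynomials (CommutativeRing.rawRing powerSeries)

  nthL-isRingMonomorphism : IsRingMonomorphism nthL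
  nthL-isRingMonomorphism = record
    { isRingHomomorphism = record
      { isSemiringHomomorphism = record
        { isNearSemiringHomomorphism = record
          { +-isMonoidHomomorphism = record
            { isMagmaHomomorphism = record
              { isRelHomomorphism = record { cong = id }
              ; homo = nthL-addL }
            ; ε-homo = λ _ → ≡.refl }
          ; *-homo = nthL-mulL }
        ; 1#-homo = nthL-one }
      ; -‿homo = nthL-map (ℤ.-_) ≡.refl }
    ; injective = id }

  -- The ring laws are pulled back along the embedding `nthL` into power series.
  polynomials : CommutativeRing 0ℓ 0ℓ
  polynomials = record
    { isCommutativeRing = RingMonomorphism.isCommutativeRing nthL-isRingMonomorphism
        (CommutativeRing.isCommutativeRing powerSeries) }

  sumL-zero : ∀ as → as ≈ₚ [] → AtOne.sumL as ≡ + 0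
  sumL-zero []       e = ≡.refl
  sumL-zero (a ∷ as) e = ≡.cong₂ ℤ._+_ (e 0) (sumL-zero as (e ∘ suc))

  sumL-cong : ∀ as bs → as ≈ₚ bs → AtOne.sumL as ≡ AtOne.sumL bs
  sumL-cong []       bs       e = ≡.sym (sumL-zero bs (λ n → ≡.sym (e n)))
  sumL-cong (a ∷ as) []       e = sumL-zero (a ∷ as) e
  sumL-cong (a ∷ as) (b ∷ bs) e = ≡.cong₂ ℤ._+_ (e 0) (sumL-cong as bs (e ∘ suc))

  sumL-replicate : ∀ n → AtOne.sumL (replicate n (+ 1)) ≡ + n
  sumL-replicate zero    = ≡.refl
  sumL-replicate (suc n) = ≡.cong (λ x → + 1 ℤ.+ x) (sumL-replicate n)

  divide : ∀ k as → (∀ n → + k Signed.∣ nthL as n) → Σ (List ℤ) λ bs → ∀ n → nthL as n ≡ nthL bs n ℤ.* + k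
  divide k []       d = [] , λ _ → ≡.refl
  divide k (a ∷ as) d with d 0 | divide k as (d ∘ suc)
  ... | Signed.divides b e | bs , es = b ∷ bs , λ { zero → e ; (suc n) → es n }

  conv-∣ : ∀ k f g n → (∀ i → i ≤ n → k Signed.∣ g i) → k Signed.∣ conv f g n
  conv-∣ k f g zero    d = Signed.∣n⇒∣m*n (f 0) (d 0 z≤n)
  conv-∣ k f g (suc n) d = Signed.∣m∣n⇒∣m+n (Signed.∣n⇒∣m*n (f 0) (d (suc n) ℕₚ.≤-refl))
    (conv-∣ k (f ∘ suc) g n (λ i i≤n → d i (ℕₚ.m≤n⇒m≤1+n i≤n)))

  -- A power series with constant term 1 is a unit, so it can be cancelled modulo k.
  conv-∣-cancel : ∀ k f g → f 0 ≡ + 1 → (∀ n → k Signed.∣ conv f g n) → ∀ n i → i ≤ n → k Signed.∣ g i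
  conv-∣-cancel k f g f₀ d zero .zero z≤n = ≡.subst (k Signed.∣_) (≡.trans (≡.cong (ℤ._* g 0) f₀) (ℤₚ.*-identityˡ _)) (d 0)
  conv-∣-cancel k f g f₀ d (suc n) i i≤ with i ℕ.≟ suc n
  ... | no i≢ = conv-∣-cancel k f g f₀ d n i (ℕₚ.≤-pred (ℕₚ.≤∧≢⇒< i≤ i≢))
  ... | yes ≡.refl = ≡.subst (k Signed.∣_) (≡.trans (≡.cong (ℤ._* g (suc n)) f₀) (ℤₚ.*-identityˡ _))
          (Signed.∣m+n∣n⇒∣m (d (suc n)) (conv-∣ k (f ∘ suc) g n (conv-∣-cancel k f g f₀ d n)))

-- The ring ℤ[ζ] modulo Φ_ℓ.

module CyclotomicIntegers (h : ℕ) where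

  open IntegerPolynomials

  ℓ : ℕ
  ℓ = 3 ℕ.+ 2 ℕ.* h

  Φ : List ℤ
  Φ = replicate ℓ (+ 1)

  open Quotient polynomials Φ using (quotient; ≈⇒≈/; multiple) public
  open CommutativeRing quotient public
  open IntegerCoefficients quotient using (fromℤ)
  open FiniteProducts quotient
  open Algebra.Properties.CommutativeSemiring.Exp commutativeSemiring
  module PSℤ = PowerSeries ℤₚ.+-*-commutativeRing

  ω : List ℤ
  ω = + 0 ∷ + 1 ∷ []

  ω*-zero : ∀ c → nthL (ω * c) 0 ≡ + 0
  ω*-zero c = nthL-mulL ω c 0

  ω*-suc : ∀ c n → nthL (ω * c) (suc n) ≡ nthL c n
  ω*-suc c n = ≡.trans (nthL-mulL ω c (suc n)) (≡.trans (ℤₚ.+-identityˡ _)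
    (≡.trans (PSℤ.conv-cong {g = nthL c} nthL-one (λ _ → ≡.refl) n) (PSℤ.conv-identityˡ (nthL c) n)))

  fromℤ≈ : ∀ a → fromℤ a ≈ a ∷ []
  fromℤ≈ (+ n) = pos n
    where
    pos : ∀ n → fromℤ (+ n) ≈ + n ∷ []
    pos zero          = ≈⇒≈/ λ { zero → ≡.refl ; (suc n) → ≡.refl }
    pos (suc zero)    = refl
    pos (suc (suc n)) = trans (+-congʳ (pos (suc n))) (reflexive (≡.cong (λ k → + k ∷ []) (ℕₚ.+-comm (suc n) 1)))
  fromℤ≈ -[1+ n ] = -‿cong (fromℤ≈ (+ suc n))

  ∷≈ : ∀ a c → a ∷ c ≈ (a ∷ []) + ω * c
  ∷≈ a c = ≈⇒≈/ λ
    { zero    → ≡.sym (≡.trans (nthL-addL (a ∷ []) (ω * c) 0) (≡.trans (≡.cong (λ x → a ℤ.+ x) (ω*-zero c)) (ℤₚ.+-identityʳ a)))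
    ; (suc n) → ≡.sym (≡.trans (nthL-addL (a ∷ []) (ω * c) (suc n)) (≡.trans (ℤₚ.+-identityˡ _) (ω*-suc c n))) }

  Φ≈0 : Φ ≈ 0#
  Φ≈0 = multiple (+ 1 ∷ []) (λ n → ≡.sym (CommutativeRing.*-identityʳ polynomials Φ n))

  ∑ω^≈replicate : ∀ n → ∑ n (ω ^_) ≈ replicate n (+ 1)
  ∑ω^≈replicate zero    = refl
  ∑ω^≈replicate (suc n) = trans (∑-sucˡ n (ω ^_)) (trans (+-congˡ {ω ^ 0} (trans (sym (*-distribˡ-∑ n ω (ω ^_))) (*-congˡ {ω} (∑ω^≈replicate n))))
    (sym (∷≈ (+ 1) (replicate n (+ 1)))))

  ∑ω≈0 : ∑ ℓ (ω ^_) ≈ 0#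
  ∑ω≈0 = trans (∑ω^≈replicate ℓ) Φ≈0

  nthL-∑ : ∀ n x j → nthL (∑ n (λ _ → x)) j ≡ nthL x j ℤ.* + n
  nthL-∑ zero    x j = ≡.sym (ℤₚ.*-zeroʳ (nthL x j))
  nthL-∑ (suc n) x j = ≡.trans (nthL-addL (∑ n (λ _ → x)) x j) (≡.trans (≡.cong (ℤ._+ nthL x j) (nthL-∑ n x j))
    (≡.trans (ℤₚ.+-comm _ (nthL x j)) (≡.sym (ℤₚ.*-suc (nthL x j) (+ n)))))

  -- If ℓ x = Φ g, then ℓ divides each coefficient of g, because Φ has constant term 1. With g = ℓ
  -- g′, cancelling ℓ over ℤ leaves x = Φ g′.
  torsionFree : ∀ x → ∑ ℓ (λ _ → x) ≈ 0# → x ≈ 0#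
  torsionFree x (multiple g e) with divide ℓ g (λ n → conv-∣-cancel (+ ℓ) (nthL Φ) (nthL g) ≡.refl ∣conv n n ℕₚ.≤-refl)
    where
    ∣conv : ∀ n → + ℓ Signed.∣ PSℤ.conv (nthL Φ) (nthL g) n
    ∣conv n = Signed.divides (nthL x n) (≡.trans (≡.sym (nthL-mulL Φ g n)) (≡.trans (≡.sym (e n)) (nthL-∑ ℓ x n)))
  ... | g′ , e′ = multiple g′ λ n → ℤₚ.*-cancelʳ-≡ _ _ (+ ℓ) (≡.trans (≡.sym (nthL-∑ ℓ x n)) (≡.trans (e n) (≡.trans (nthL-mulL Φ g n)
      (≡.trans (PSℤ.conv-cong {nthL Φ} (λ _ → ≡.refl) (λ i → ≡.trans (e′ i) (ℤₚ.*-comm _ (+ ℓ))) n)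
      (≡.trans (PSℤ.conv-comm (nthL Φ) (λ i → + ℓ ℤ.* nthL g′ i) n) (≡.trans (PSℤ.conv-*ˡ (+ ℓ) (nthL g′) (nthL Φ) n)
      (≡.trans (ℤₚ.*-comm (+ ℓ) _) (≡.cong (ℤ._* + ℓ) (≡.trans (PSℤ.conv-comm (nthL g′) (nthL Φ) n) (≡.sym (nthL-mulL Φ g′ n)))))))))))

  open Horner quotient ω using (horner)

  -- ω is the class of the variable, so evaluating a polynomial there returns its own class. A value
  -- 0 therefore means divisibility by Φ.
  horner≈ : ∀ c → horner c ≈ c
  horner≈ []      = refl
  horner≈ (a ∷ c) = trans (+-cong (fromℤ≈ a) (*-congˡ {ω} {horner c} {c} (horner≈ c))) (sym (∷≈ a c))

  ≈0⇒∣ : ∀ {c} → c ≈ 0# → Σ (List ℤ) λ g → c ≈ₚ mulL Φ g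
  ≈0⇒∣ (multiple g e) = g , e

  horner≈0⇒∣ : ∀ c → horner c ≈ 0# → Σ (List ℤ) λ g → c ≈ₚ mulL Φ g
  horner≈0⇒∣ c e = ≈0⇒∣ (trans (sym (horner≈ c)) e)

  ω-cyclotomic : CyclotomicRoot quotient ω ℓ
  ω-cyclotomic = record { ∑ω≈0 = ∑ω≈0 ; torsionFree = torsionFree }

-- From vanishing at a root of unity to divisibility and congruences.

-- In the form 3 + 2h, the truncated differences ℓ ∸ 2 and ℓ ∸ 3 reduce to 1 + 2h and 2h, and the
-- number of outer odd exponents is h.
oddPrime-form : ∀ ℓ → Prime ℓ → ℓ ≢ 2 → Σ ℕ λ h → ℓ ≡ 3 ℕ.+ 2 ℕ.* h
oddPrime-form ℓ ℓ-prime ℓ≢2 with ℓ ℕ.% 2 | ℓ ℕ./ 2 | DivMod.m≡m%n+[m/n]*n ℓ 2 | DivMod.m%n<n ℓ 2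
... | 0 | k | e | _ with prime⇒irreducible ℓ-prime (ℕ∣.divides k e)
...   | inj₂ 2≡ℓ = ⊥-elim (ℓ≢2 (≡.sym 2≡ℓ))
oddPrime-form ℓ ℓ-prime ℓ≢2 | 1 | zero | ≡.refl | _ = ⊥-elim (ℕ.nonTrivial⇒≢1 ⦃ prime⇒nonTrivial ℓ-prime ⦄ ≡.refl)
oddPrime-form ℓ ℓ-prime ℓ≢2 | 1 | suc k | e | _ = k , ≡.trans e (≡.cong (3 ℕ.+_) (ℕₚ.*-comm k 2))
oddPrime-form ℓ ℓ-prime ℓ≢2 | suc (suc _) | _ | _ | ℕ.s≤s (ℕ.s≤s ())

crank-specialises : ∀ h m N → evalAt1 (Cgen (3 ℕ.+ 2 ℕ.* h) m N) ≡ pGen ((3 ℕ.+ 2 ℕ.* h) ℕ.* m ℕ.+ 2 ℕ.* h) 3 N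
crank-specialises h m N = ≡.trans (≡.sym (AtOne.eval≡evalAt1 (Cgen (3 ℕ.+ 2 ℕ.* h) m N)))
  (≡.trans (AtOne.at (AtOne.Cgen~crankSeries (3 ℕ.+ 2 ℕ.* h) m) N) (AtOne.crankSeries≡pGen h m N))

coeffLP-cong : ∀ l c d → (∀ n → nthL c n ≡ nthL d n) → ∀ j → coeffLP (mkLP l c) j ≡ coeffLP (mkLP l d) j
coeffLP-cong l c d e j with j ℤ.- l
... | + i      = e i
... | -[1+ _ ] = ≡.refl

sumL-multiple : ∀ ℓ c g → (∀ n → nthL c n ≡ nthL (mulL (replicate ℓ (+ 1)) g) n) → AtOne.sumL c ≡ AtOne.sumL g ℤ.* + ℓ
sumL-multiple ℓ c g e = ≡.trans (IntegerPolynomials.sumL-cong c (mulL (replicate ℓ (+ 1)) g) e)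
    (≡.trans (AtOne.sumL-mulL (replicate ℓ (+ 1)) g) (≡.trans (≡.cong (ℤ._* AtOne.sumL g) (IntegerPolynomials.sumL-replicate ℓ)) (ℤₚ.*-comm (+ ℓ) (AtOne.sumL g))))

-- The lowest exponent l passes to the cofactor, since Φ starts at exponent 0. The second part is
-- evaluation at 1, where Φ takes the value ℓ.
multiple⇒∣ : ∀ ℓ l c g → (∀ n → nthL c n ≡ nthL (mulL (replicate ℓ (+ 1)) g) n) → (cyclotomicPrime ℓ ∣LP mkLP l c) × (+ ℓ ℤ∣.∣ AtOne.sumL c)
multiple⇒∣ ℓ l c g e = (mkLP l g , λ j → ≡.trans (coeffLP-cong l c (mulL (replicate ℓ (+ 1)) g) e j) (≡.cong (λ k → coeffLP (mkLP k (mulL (replicate ℓ (+ 1)) g)) j) (≡.sym (ℤₚ.+-identityˡ l))))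
  , Signed.∣⇒∣ᵤ (Signed.divides (AtOne.sumL g) (sumL-multiple ℓ c g e))

-- 4 (r² + r) + 1 = (2r + 1)².
nonResidue-avoids : ∀ ℓ δ → QNR ℓ (+ 4 ℤ.* δ ℤ.+ + 1) → ∀ n N → + (ℓ ℕ.* n) ℤ.+ δ ≡ + N →
  ∀ s r → N ≢ s ℕ.* ℓ ℕ.+ r ℕ.* suc r
nonResidue-avoids ℓ δ qnr n N e s r ≡.refl = qnr (+ (1 ℕ.+ 2 ℕ.* r) , Signed.∣⇒∣ᵤ (Signed.divides (+ 4 ℤ.* (+ s ℤ.- + n)) identity))
  where
  module I = IntegerCoefficients ℤₚ.+-*-commutativeRing
  L = + ℓ
  δ≡ : δ ≡ (+ s ℤ.* L ℤ.+ + r ℤ.* (+ 1 ℤ.+ + r)) ℤ.- L ℤ.* + n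
  δ≡ = ≡.trans (I.solve 2 (λ x d → d I.:= (x I.:+ d) I.:- x) ≡.refl (L ℤ.* + n) δ)
    (≡.cong (ℤ._- L ℤ.* + n) (≡.trans (≡.cong (ℤ._+ δ) (≡.sym (ℤₚ.pos-* ℓ n))) (≡.trans e
      (≡.cong₂ ℤ._+_ (ℤₚ.pos-* s ℓ) (ℤₚ.pos-* r (suc r))))))
  square : + (1 ℕ.+ 2 ℕ.* r) ≡ + 1 ℤ.+ + 2 ℤ.* + r
  square = ≡.cong (λ x → + 1 ℤ.+ x) (ℤₚ.pos-* 2 r)
  identity : (+ 4 ℤ.* δ ℤ.+ + 1) ℤ.- + (1 ℕ.+ 2 ℕ.* r) ℤ.* + (1 ℕ.+ 2 ℕ.* r) ≡ + 4 ℤ.* (+ s ℤ.- + n) ℤ.* L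
  identity = ≡.trans (≡.cong₂ (λ d x → (+ 4 ℤ.* d ℤ.+ + 1) ℤ.- x ℤ.* x) δ≡ square)
    (I.solve 4 (λ s L r n →
      (I.con (+ 4) I.:* ((s I.:* L I.:+ r I.:* (I.con (+ 1) I.:+ r)) I.:- L I.:* n) I.:+ I.con (+ 1)) I.:- (I.con (+ 1) I.:+ I.con (+ 2) I.:* r) I.:* (I.con (+ 1) I.:+ I.con (+ 2) I.:* r)
      I.:= I.con (+ 4) I.:* (s I.:- n) I.:* L) ≡.refl (+ s) L (+ r) (+ n))

module CrankCongruences (K : CommutativeRing 0ℓ 0ℓ) (ω : CommutativeRing.Carrier K) (h m : ℕ)
  (ℓ-prime : Prime (3 ℕ.+ 2 ℕ.* h)) (ω-cyclotomic : CyclotomicRoot K ω (3 ℕ.+ 2 ℕ.* h))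
  (horner≈0⇒∣ : ∀ c → CommutativeRing._≈_ K (Horner.horner K ω c) (CommutativeRing.0# K) →
    Σ (List ℤ) λ g → ∀ n → nthL c n ≡ nthL (mulL (replicate (3 ℕ.+ 2 ℕ.* h) (+ 1)) g) n) where

  open CommutativeRing K using (_≈_; 0#)
  module W = RootOfUnity K ω h m ℓ-prime ω-cyclotomic
  module E = Evaluation K ω W.ω⁻¹ W.ω^ℓ≈1

  eval≈0⇒∣ : ∀ f → E.eval f ≈ 0# → (cyclotomicPrime (3 ℕ.+ 2 ℕ.* h) ∣LP f) × (+ (3 ℕ.+ 2 ℕ.* h) ℤ∣.∣ evalAt1 f)
  eval≈0⇒∣ (mkLP l c) e = multiple⇒∣ (3 ℕ.+ 2 ℕ.* h) l c (proj₁ d) (proj₂ d)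
    where d = horner≈0⇒∣ c (E.eval≈0⇒horner≈0 l c e)

  crankCoefficient-vanish : ∀ N → (∀ s r → N ≢ s ℕ.* (3 ℕ.+ 2 ℕ.* h) ℕ.+ r ℕ.* suc r) → E.eval (Cgen (3 ℕ.+ 2 ℕ.* h) m N) ≈ 0#
  crankCoefficient-vanish N N≢ = CommutativeRing.trans K (E.at (E.Cgen~crankSeries (3 ℕ.+ 2 ℕ.* h) m) N) (W.crankSeries-vanish N N≢)

  -- The degree is a separate variable i so that its sign can be inspected: δ may be negative enough
  -- to make ℓ n + δ negative.
  congruence : ∀ δ → QNR (3 ℕ.+ 2 ℕ.* h) (+ 4 ℤ.* δ ℤ.+ + 1) → ∀ n i → + ((3 ℕ.+ 2 ℕ.* h) ℕ.* n) ℤ.+ δ ≡ i →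
    (cyclotomicPrime (3 ℕ.+ 2 ℕ.* h) ∣LP SLP.coeffZ (Cgen (3 ℕ.+ 2 ℕ.* h) m) i) × ((+ (3 ℕ.+ 2 ℕ.* h)) ℤ∣.∣ SZ.coeffZ (pGen ((3 ℕ.+ 2 ℕ.* h) ℕ.* m ℕ.+ 2 ℕ.* h) 3) i)
  congruence δ qnr n (+ N) e = proj₁ divisible , ≡.subst (+ (3 ℕ.+ 2 ℕ.* h) ℤ∣.∣_) (crank-specialises h m N) (proj₂ divisible)
    where
    divisible = eval≈0⇒∣ (Cgen (3 ℕ.+ 2 ℕ.* h) m N) (crankCoefficient-vanish N (nonResidue-avoids (3 ℕ.+ 2 ℕ.* h) δ qnr n N e))
  -- In negative degree both coefficients are 0 by definition of `coeffZ`.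
  congruence δ qnr n -[1+ k ] e = eval≈0⇒∣ zeroLP E.eval-zeroLP

theorem1p2 : (ℓ m : ℕ) → Prime ℓ → ℓ ≢ 2 →
    ((N : ℕ) → evalAt1 (Cgen ℓ m N) ≡ p (ℓ ℕ.* m ℕ.+ (ℓ ℕ.∸ 3)) 3 N)
    × ((δ : ℤ) → QNR ℓ (+ 4 ℤ.* δ ℤ.+ + 1) → (n : ℕ) →
    (cyclotomicPrime ℓ ∣LP SLP.coeffZ (Cgen ℓ m) (+ (ℓ ℕ.* n) ℤ.+ δ))
    × ((+ ℓ) ℤ∣.∣ SZ.coeffZ (pGen (ℓ ℕ.* m ℕ.+ (ℓ ℕ.∸ 3)) 3) (+ (ℓ ℕ.* n) ℤ.+ δ)))
theorem1p2 ℓ m ℓ-prime ℓ≢2 = byForm (oddPrime-form ℓ ℓ-prime ℓ≢2) ℓ-prime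
  where
  Conclusion : ℕ → Set
  Conclusion ℓ = ((N : ℕ) → evalAt1 (Cgen ℓ m N) ≡ p (ℓ ℕ.* m ℕ.+ (ℓ ℕ.∸ 3)) 3 N)
    × ((δ : ℤ) → QNR ℓ (+ 4 ℤ.* δ ℤ.+ + 1) → (n : ℕ) →
    (cyclotomicPrime ℓ ∣LP SLP.coeffZ (Cgen ℓ m) (+ (ℓ ℕ.* n) ℤ.+ δ))
    × ((+ ℓ) ℤ∣.∣ SZ.coeffZ (pGen (ℓ ℕ.* m ℕ.+ (ℓ ℕ.∸ 3)) 3) (+ (ℓ ℕ.* n) ℤ.+ δ)))
  byForm : (Σ ℕ λ h → ℓ ≡ 3 ℕ.+ 2 ℕ.* h) → Prime ℓ → Conclusion ℓ
  byForm (h , ≡.refl) ℓ-prime = crank-specialises h m , λ δ qnr n →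
    CrankCongruences.congruence Z.quotient Z.ω h m ℓ-prime Z.ω-cyclotomic Z.horner≈0⇒∣ δ qnr n (+ (Z.ℓ ℕ.* n) ℤ.+ δ) ≡.refl
    where module Z = CyclotomicIntegers h
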